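{- Let $v \geq 4$ be an integer. If there exists a $\mathrm{TTS}(v)$ with a Hamiltonian $2$-BIG, then there exists a $\mathrm{TTS}(3v)$ with a Hamiltonian $2$-BIG.
   Context: A twofold triple system of order $v$, denoted $\mathrm{TTS}(v)$, is a pair $(V,\mathcal{B})$ where $V$ is a set of $v$ points and $\mathcal{B}$ is a collection of $3$-element subsets of $V$ (called blocks or triples; repeated blocks are permitted, i.e. $\mathcal{B}$ is a multiset) such that each $2$-element subset of $V$ is contained in exactly two blocks of $\mathcal{B}$, counted with multiplicity. The $2$-block-intersection graph ($2$-BIG) of $(V,\mathcal{B})$ is the graph whose vertices are the blocks in $\mathcal{B}$ (repeated blocks giving distinct vertices), where two vertices $B_1,B_2$ are adjacent if and only if $|B_1\cap B_2|=2$. A graph is Hamiltonian if it contains a Hamilton cycle (a cycle, of length at least $3$, through all vertices). -}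

module Defs where

open import Data.Fin using (Fin)
open import Data.Fin.Subset using (Subset; ∣_∣; _∩_)
open import Data.Fin.Subset.Properties using (_⊆?_; ∩-comm; ∩-idem)
open import Data.List using (List; _∷_; _∷ʳ_; length; filter; lookup)
open import Data.List.Membership.Propositional using (_∈_)
open import Data.List.Membership.Propositional.Properties using (∈-lookup)
open import Data.List.Relation.Unary.All using (All)
import Data.List.Relation.Unary.All as All
open import Data.List.Relation.Unary.Linked using (Linked)
open import Data.List.Relation.Unary.Unique.Propositional using (Unique)
open import Data.Nat using (ℕ; _≤_)
open import Relation.Binary.Definitions using (Symmetric)
open import Relation.Binary.PropositionalEquality using (_≡_; sym; trans; cong)
open import Relation.Nullary using (¬_)

-- The point set is Fin v.  The multiset of blocks is given by a list, whose
-- repeated entries are the repeated blocks.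
record TTS (v : ℕ) : Set where
  field
    blocks     : List (Subset v)
    block-size : All (λ B → ∣ B ∣ ≡ 3) blocks
    balanced   : (P : Subset v) → ∣ P ∣ ≡ 2 →
                 length (filter (P ⊆?_) blocks) ≡ 2

record SimpleGraph : Set₁ where
  field
    Vertex   : Set
    Adj      : Vertex → Vertex → Set
    adj-sym  : Symmetric Adj
    no-loops : (x : Vertex) → ¬ Adj x x

-- The Hamilton cycle is start, rest₀, rest₁, …, back to start.
record HamiltonCycle (G : SimpleGraph) : Set where
  open SimpleGraph G
  field
    start    : Vertex
    rest     : List Vertex
    long     : 3 ≤ length (start ∷ rest)
    distinct : Unique (start ∷ rest)
    closed   : Linked Adj (start ∷ (rest ∷ʳ start))
    spanning : (x : Vertex) → x ∈ (start ∷ rest)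

Hamiltonian : SimpleGraph → Set
Hamiltonian G = HamiltonCycle G

-- Vertices are positions in the list of blocks, so that the copies of a
-- repeated block are distinct vertices.
2-BIG : {v : ℕ} → TTS v → SimpleGraph
2-BIG D = record
  { Vertex   = Fin (length blocks)
  ; Adj      = λ i j → ∣ lookup blocks i ∩ lookup blocks j ∣ ≡ 2
  ; adj-sym  = λ {i} {j} e →
      trans (cong ∣_∣ (∩-comm (lookup blocks j) (lookup blocks i))) e
  ; no-loops = λ i e → 3≢2
      (trans (sym (All.lookup block-size (∈-lookup {xs = blocks} i)))
        (trans (cong ∣_∣ (sym (∩-idem (lookup blocks i)))) e))
  }
  where
  open TTS D
  3≢2 : ¬ (3 ≡ 2)
  3≢2 ()

{-# OPTIONS --safe #-}

-- Put the given TTS(v) on each of three copies of its point set, and cover the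
-- pairs of points from different copies by the Latin squares x + y and x + y + 1
-- of order v.  This is a TTS(3v) whose 2-BIG is disconnected: each copy has its
-- given Hamilton cycle, and the Latin square triples have one that runs along
-- the rows x = v - 1, ..., 0 in turn.  Trading one block from each copy and six Latin square
-- triples for nine other triples keeps the design balanced and
-- connects the parts.  Removing its block opens the cycle of each copy into a
-- path, and the opened cycles fit together with the traded triples into one
-- Hamilton cycle; the trade lies in three rows and three columns, so that the
-- same pattern works for every v ≥ 4.  All counting is done with 0/1 indicators.

module Submission where

open import Defs
import Algebra.Properties.CommutativeMonoid.Sum
open import Data.Bool using (Bool; true; false; if_then_else_; _∧_; _∨_; T)
open import Data.Empty using (⊥-elim; ⊥)
open import Data.Fin using (Fin; zero; suc; toℕ; combine; remQuot)
import Data.Fin as Fin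
open import Data.Fin.Patterns using (0F; 1F; 2F)
open import Data.Fin.Permutation using (Permutation′; transpose; _∘ₚ_; _⟨$⟩ʳ_; _⟨$⟩ˡ_; inverseʳ; inverseˡ)
open import Data.Fin.Properties using (fromℕ<-cong; fromℕ<-toℕ; toℕ<n; combine-injective; combine-remQuot; toℕ-fromℕ<)
open import Data.Fin.Subset using (Subset; ∣_∣; _∩_; inside; outside; _⊆_)
import Data.Fin.Subset as Subset
open import Data.Fin.Subset.Properties using (_⊆?_)
open import Data.List using (List; []; _∷_; [_]; _++_; _∷ʳ_; map; length; filter; lookup; allFin; tabulate; concatMap)
open import Data.List.Membership.Propositional.Properties using (∈-allFin; ∈-lookup)
open import Data.List.Membership.Propositional.Properties.WithK using (unique∧set⇒bag)
open import Data.List.Properties using (map-∘; map-cong; map-tabulate; tabulate-lookup; map-++; length-map; length-tabulate)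
open import Data.List.Relation.Binary.BagAndSetEquality using (∼bag⇒↭)
open import Data.List.Relation.Binary.Permutation.Propositional using (_↭_)
import Data.List.Relation.Binary.Permutation.Propositional.Properties as Perm
open import Data.List.Relation.Unary.All using (All; []; _∷_; all?)
import Data.List.Relation.Unary.All as All
import Data.List.Relation.Unary.All.Properties as All
open import Data.List.Relation.Unary.Linked using (Linked; []; [-]; _∷_)
import Data.List.Relation.Unary.Linked.Properties as Linked
import Data.List.Relation.Unary.Unique.Propositional.Properties as Unique
open import Data.Maybe using (Maybe; just; nothing)
import Data.Maybe as Maybe
open import Data.Nat using (ℕ; zero; suc; _+_; _*_; _≤_; z≤n; s≤s; _<_; ∣_-_∣; _≤?_; _%_)
import Data.Nat as ℕ
open import Data.Nat.DivMod using (_mod_; [m+n]%n≡m%n; m%n<n; m≡m%n+[m/n]*n; m<n⇒m%n≡m; _/_)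
open import Data.Nat.Divisibility using (_∣_; divides; ∣m+n∣m⇒∣n; ∣⇒≤)
open import Data.Nat.ListAction using (sum)
open import Data.Nat.ListAction.Properties using (sum-↭; sum-++)
open import Data.Nat.Properties
open import Data.Nat.Tactic.RingSolver using (solve-∀)
open import Data.Product using (Σ-syntax; ∃-syntax; _×_; _,_; proj₁; proj₂; uncurry)
open import Data.Product.Properties using (≡-dec; ,-injectiveʳ)
open import Data.Sum using (_⊎_; inj₁; inj₂)
open import Data.Unit using (⊤)
open import Data.Vec using ([]; _∷_)
import Data.Vec as Vec
import Data.Vec.Properties as Vec
open import Function using (_∘_; id)
open import Function.Bundles using (mk⇔)
open import Level using (0ℓ)
open import Relation.Binary.Core using (Rel)
open import Relation.Binary.Definitions using (DecidableEquality; tri<; tri≈; tri>)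
open import Relation.Binary.PropositionalEquality using (_≡_; _≢_; refl; sym; trans; cong; cong₂; subst; subst₂; module ≡-Reasoning)
open import Relation.Nullary using (Dec; yes; no; does; contradiction)
open import Relation.Nullary.Decidable using (dec-true; dec-false; True; toWitness; ¬?; _⊎-dec_; _×-dec_)
open import Relation.Unary using (Decidable)

open Algebra.Properties.CommutativeMonoid.Sum +-0-commutativeMonoid using (sum-cong-≗; ∑-distrib-+; ∑-comm; sum-syntax; sum-replicate-zero) renaming (sum to ∑)

-- Nothing is known about the given Hamilton cycle, so only what holds around every block may be
-- used. The two neighbours of a block on the cycle meet it in two different pairs: a pair common to
-- all three would be covered three times. Two pairs in a 3-set share one point e, so the block is
-- {e, f, g} with e, f in one neighbour and e, g in the other. A permutation of the points takes (e,
-- f, g) to any prescribed triple, so the trade may dictate where each opened cycle is entered and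
-- left.
--
-- The numbers three, six and nine balance the pairs. Each new triple has one pair inside a copy and
-- two pairs across copies. The 9 inside pairs are those of the three removed blocks, and the 18
-- cross pairs are those of the six removed Latin square triples.
--
-- The finite part is evaluated once, on labels with natural numbers in place of residues. Equality
-- of the two multisets of pairs survives any identification of labels. Adjacency needs more:
-- distinct labels whose numbers are at most 3 apart must remain distinct modulo v, which is where v
-- ≥ 4 enters.

ind : Bool → ℕ
ind b = if b then 1 else 0

ind≤1 : ∀ b → ind b ≤ 1
ind≤1 true  = s≤s z≤n
ind≤1 false = z≤n

-- Paths with named ends, and ordered triples

-- Unlike in `Linked`, both ends are indices, so that long cycles can be assembled from pieces by
-- one connecting edge at a time.
data Path {A : Set} (R : Rel A 0ℓ) : A → A → List A → Set where
  end  : ∀ x → Path R x x (x ∷ [])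
  _∷_  : ∀ {x y z ys} → R x y → Path R y z ys → Path R x z (x ∷ ys)

module _ {A : Set} {R : Rel A 0ℓ} where

  join : ∀ {a b c d xs ys} → Path R a b xs → R b c → Path R c d ys → Path R a d (xs ++ ys)
  join (end _) r q = r ∷ q
  join (s ∷ p) r q = s ∷ join p r q

  path⇒linked : ∀ {a b c xs} → Path R a b xs → R b c → Linked R (xs ∷ʳ c)
  path⇒linked (end _)         r = r ∷ [-]
  path⇒linked (s ∷ end _)     r = s ∷ r ∷ [-]
  path⇒linked (s ∷ p@(_ ∷ _)) r = s ∷ path⇒linked p r

  linked⇒path : ∀ {a c} xs → Linked R (a ∷ (xs ∷ʳ c)) → ∃[ b ] Path R a b (a ∷ xs) × R b c
  linked⇒path []       (r ∷ _) = _ , end _ , r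
  linked⇒path (x ∷ xs) (r ∷ l) with b , p , s ← linked⇒path xs l = b , r ∷ p , s

  path-start : ∀ {a b x xs} → Path R a b (x ∷ xs) → a ≡ x
  path-start (end _) = refl
  path-start (_ ∷ _) = refl

  all-final : ∀ {P : A → Set} {a b xs} → All P xs → Path R a b xs → P b
  all-final (px ∷ _)  (end _) = px
  all-final (_ ∷ pxs) (_ ∷ p) = all-final pxs p

  -- Makes a property of the vertices available at each edge, for an edge map in `mapPath` that
  -- depends on it.
  restrict : ∀ {P : A → Set} {a b xs} → All P xs → Path R a b xs →
             Path (λ x y → P x × P y × R x y) a b xs
  restrict _                     (end x)           = end x
  restrict (px ∷ py ∷ [])        (r ∷ end _)       = (px , py , r) ∷ end _
  restrict (px ∷ pxs@(py ∷ _))   (r ∷ p@(_ ∷ _))   = (px , py , r) ∷ restrict pxs p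

mapPath : ∀ {A B : Set} {R : Rel A 0ℓ} {S : Rel B 0ℓ} (f : A → B) → (∀ {x y} → R x y → S (f x) (f y)) →
          ∀ {a b xs} → Path R a b xs → Path S (f a) (f b) (map f xs)
mapPath f h (end x) = end (f x)
mapPath f h (r ∷ p) = h r ∷ mapPath f h p

Triple : Set → Set
Triple A = A × A × A

mapTriple : ∀ {A B : Set} → (A → B) → Triple A → Triple B
mapTriple f (a , b , c) = f a , f b , f c

Distinct : ∀ {A : Set} → Triple A → Set
Distinct (a , b , c) = a ≢ b × a ≢ c × b ≢ c

two-of-three : ∀ {x y z} → x ≤ 1 → y ≤ 1 → z ≤ 1 → x + y + z ≡ 2 →
               (x ≡ 1 × y ≡ 1) ⊎ (x ≡ 1 × z ≡ 1) ⊎ (y ≡ 1 × z ≡ 1)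
two-of-three (s≤s z≤n) (s≤s z≤n) z≤n       _ = inj₁ (refl , refl)
two-of-three (s≤s z≤n) z≤n       (s≤s z≤n) _ = inj₂ (inj₁ (refl , refl))
two-of-three z≤n       (s≤s z≤n) (s≤s z≤n) _ = inj₂ (inj₂ (refl , refl))
two-of-three z≤n       z≤n       z≤n       ()
two-of-three z≤n       z≤n       (s≤s z≤n) ()
two-of-three z≤n       (s≤s z≤n) z≤n       ()

-- Incidence counts, cyclic Gray codes and their cuts

module Incidence {A : Set} (_≟_ : DecidableEquality A) where

  δ : A → A → ℕ
  δ x y = ind (does (x ≟ y))

  δ-refl : ∀ x → δ x x ≡ 1
  δ-refl x = cong ind (dec-true (x ≟ x) refl)

  δ-≢ : ∀ {x y} → x ≢ y → δ x y ≡ 0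
  δ-≢ {x} {y} x≢y = cong ind (dec-false (x ≟ y) x≢y)

  δ-exclusive : ∀ {p q} → p ≢ q → ∀ a → δ p a * δ q a ≡ 0
  δ-exclusive {p} {q} p≢q a with p ≟ a | q ≟ a
  ... | yes refl | yes refl = contradiction refl p≢q
  ... | yes _    | no _     = refl
  ... | no _     | _        = refl

  mem : A → Triple A → ℕ
  mem x (a , b , c) = δ x a + δ x b + δ x c

  common : Triple A → Triple A → ℕ
  common (a , b , c) u = mem a u + mem b u + mem c u

  -- A record rather than the bare equation, so that both triples can be inferred from the type.
  record Adjacent (t u : Triple A) : Set where
    constructor adjacent
    field
      common≡2 : common t u ≡ 2

  open Adjacent public

  cov : A → A → Triple A → ℕ
  cov p q t = mem p t * mem q t

  cover : A → A → List (Triple A) → ℕ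
  cover p q ts = sum (map (cov p q) ts)

  cover-++ : ∀ p q ts us → cover p q (ts ++ us) ≡ cover p q ts + cover p q us
  cover-++ p q ts us = trans (cong sum (map-++ (cov p q) ts us)) (sum-++ (map (cov p q) ts) _)

  -- A cyclic 2-intersecting Gray code. A Hamilton cycle visits every block exactly once, so its
  -- list of blocks is the whole multiset of blocks, and one list carries both the design and the
  -- cycle.
  record GrayCode : Set where
    field
      {first final} : Triple A
      triples  : List (Triple A)
      path     : Path Adjacent first final triples
      closes   : Adjacent final first
      long     : 3 ≤ length triples
      distinct : All Distinct triples
      balanced : ∀ {p q} → p ≢ q → cover p q triples ≡ 2

  δ-sym : ∀ x y → δ x y ≡ δ y x
  δ-sym x y with x ≟ y
  ... | yes refl = sym (δ-refl x)
  ... | no x≢y   = sym (δ-≢ (x≢y ∘ sym))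

  common-sym : ∀ t u → common t u ≡ common u t
  common-sym (a , b , c) (d , e , f)
    rewrite δ-sym d a | δ-sym d b | δ-sym d c | δ-sym e a | δ-sym e b | δ-sym e c | δ-sym f a | δ-sym f b | δ-sym f c
    = transpose-sum (δ a d) (δ a e) (δ a f) (δ b d) (δ b e) (δ b f) (δ c d) (δ c e) (δ c f)
    where
    transpose-sum : ∀ x₁ x₂ x₃ y₁ y₂ y₃ z₁ z₂ z₃ →
      (x₁ + x₂ + x₃) + (y₁ + y₂ + y₃) + (z₁ + z₂ + z₃) ≡ (x₁ + y₁ + z₁) + (x₂ + y₂ + z₂) + (x₃ + y₃ + z₃)
    transpose-sum = solve-∀

  mem≤1 : ∀ {t} → Distinct t → ∀ x → mem x t ≤ 1
  mem≤1 {a , b , c} (a≢b , a≢c , b≢c) x with x ≟ a | x ≟ b | x ≟ c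
  ... | yes refl | yes refl | _        = contradiction refl a≢b
  ... | yes refl | no _     | yes refl = contradiction refl a≢c
  ... | yes _    | no _     | no _     = s≤s z≤n
  ... | no _     | yes refl | yes refl = contradiction refl b≢c
  ... | no _     | yes _    | no _     = s≤s z≤n
  ... | no _     | no _     | yes _    = s≤s z≤n
  ... | no _     | no _     | no _     = z≤n

  -- Lets the last block of a path be counted apart from earlier ones without naming its position.
  cov-final≤cover : ∀ {R : Rel (Triple A) 0ℓ} {a b ts} p q → Path R a b ts → cov p q b ≤ cover p q ts
  cov-final≤cover p q (end x) = m≤m+n _ _
  cov-final≤cover p q (_ ∷ π) = ≤-trans (cov-final≤cover p q π) (m≤n+m _ _)

  -- The block {e, f, g} has been cut out of a Gray code; the ends of the
  -- remaining path met it in {e, f} and in {e, g}.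
  record CutCode (e f g : A) : Set where
    field
      {first final} : Triple A
      triples  : List (Triple A)
      path     : Path Adjacent first final triples
      distinct : All Distinct triples
      balanced : ∀ {p q} → p ≢ q → cover p q triples + cov p q (e , f , g) ≡ 2
      e∈first  : mem e first ≡ 1
      f∈first  : mem f first ≡ 1
      e∈final  : mem e final ≡ 1
      g∈final  : mem g final ≡ 1

  -- The neighbours `u` and `z` of the first block `t` contain two of its three points each.
  -- `thrice` excludes that these are the same two; the point shared by the two different pairs
  -- becomes e, the other point in `u` becomes f, the other point in `z` becomes g.
  cut : GrayCode → ∃[ e ] ∃[ f ] ∃[ g ] Distinct (e , f , g) × CutCode e f g
  cut record { path = end _ ; long = s≤s () }
  cut record { path = _ ∷ end _ ; long = s≤s (s≤s ()) }
  -- With at least three blocks, `z` ends a path that starts after `u`, so `t`, `u` and `z`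
  -- contribute three separate terms to `cover`.
  cut record { final = z ; triples = t@(a , b , c) ∷ u ∷ _ ; path = t~u ∷ π@(_∷_ {ys = us} _ π′) ; closes = closes
             ; distinct = d@(a≢b , a≢c , b≢c) ∷ ds ; balanced = bal } =
    choose (two-of-three (mem≤1 (All.head ds) a) (mem≤1 (All.head ds) b) (mem≤1 (All.head ds) c) (common≡2 t~u))
           (two-of-three (mem≤1 (all-final ds π) a) (mem≤1 (all-final ds π) b) (mem≤1 (all-final ds π) c)
                         (trans (common-sym t z) (common≡2 closes)))
    where
    Result : Set
    Result = ∃[ e ] ∃[ f ] ∃[ g ] Distinct (e , f , g) × CutCode e f g
    build : ∀ e f g → Distinct (e , f , g) → (∀ x → mem x (e , f , g) ≡ mem x t) →
            mem e u ≡ 1 × mem f u ≡ 1 → mem e z ≡ 1 × mem g z ≡ 1 → Result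
    build e f g d′ same (eu , fu) (ez , gz) = e , f , g , d′ , record
      { path = π ; distinct = ds
      ; balanced = λ {p} {q} p≢q → trans (cong₂ (λ m n → cover p q (u ∷ us) + m * n) (same p) (same q))
          (trans (+-comm (cover p q (u ∷ us)) _) (bal p≢q))
      ; e∈first = eu ; f∈first = fu ; e∈final = ez ; g∈final = gz }
    -- The pair {p, q} cannot lie in t and in both of its neighbours u and z.
    thrice : ∀ {p q} → p ≢ q → mem p t ≡ 1 → mem q t ≡ 1 → mem p u ≡ 1 × mem q u ≡ 1 → mem p z ≡ 1 × mem q z ≡ 1 → Result
    thrice {p} {q} p≢q pt qt (pu , qu) (pz , qz) = contradiction
      (≤-trans (+-mono-≤ (≤-reflexive (sym (cong₂ _*_ pt qt))) (+-mono-≤ (≤-reflexive (sym (cong₂ _*_ pu qu)))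
        (≤-trans (≤-reflexive (sym (cong₂ _*_ pz qz))) (cov-final≤cover p q π′)))) (≤-reflexive (bal p≢q)))
      λ { (s≤s (s≤s ())) }
    at : mem a t ≡ 1
    at = cong₂ _+_ (cong₂ _+_ (δ-refl a) (δ-≢ a≢b)) (δ-≢ a≢c)
    bt : mem b t ≡ 1
    bt = cong₂ _+_ (cong₂ _+_ (δ-≢ (a≢b ∘ sym)) (δ-refl b)) (δ-≢ b≢c)
    ct : mem c t ≡ 1
    ct = cong₂ _+_ (cong₂ _+_ (δ-≢ (a≢c ∘ sym)) (δ-≢ (b≢c ∘ sym))) (δ-refl c)
    Two : Triple A → Set
    Two w = (mem a w ≡ 1 × mem b w ≡ 1) ⊎ (mem a w ≡ 1 × mem c w ≡ 1) ⊎ (mem b w ≡ 1 × mem c w ≡ 1)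
    choose : Two u → Two z → Result
    choose (inj₁ p) (inj₁ q) = thrice a≢b at bt p q
    choose (inj₁ (p , q)) (inj₂ (inj₁ (r , s))) = build a b c d (λ _ → refl) (p , q) (r , s)
    choose (inj₁ (p , q)) (inj₂ (inj₂ (r , s))) =
      build b a c (a≢b ∘ sym , b≢c , a≢c) (λ x → bac (δ x a) (δ x b) (δ x c)) (q , p) (r , s)
      where
      bac : ∀ k l m → l + k + m ≡ k + l + m
      bac = solve-∀
    choose (inj₂ (inj₁ (p , q))) (inj₁ (r , s)) =
      build a c b (a≢c , a≢b , b≢c ∘ sym) (λ x → acb (δ x a) (δ x b) (δ x c)) (p , q) (r , s)
      where
      acb : ∀ k l m → k + m + l ≡ k + l + m
      acb = solve-∀
    choose (inj₂ (inj₁ p)) (inj₂ (inj₁ q)) = thrice a≢c at ct p q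
    choose (inj₂ (inj₁ (p , q))) (inj₂ (inj₂ (r , s))) =
      build c a b (a≢c ∘ sym , b≢c ∘ sym , a≢b) (λ x → cab (δ x a) (δ x b) (δ x c)) (q , p) (s , r)
      where
      cab : ∀ k l m → m + k + l ≡ k + l + m
      cab = solve-∀
    choose (inj₂ (inj₂ (p , q))) (inj₁ (r , s)) =
      build b c a (b≢c , a≢b ∘ sym , a≢c ∘ sym) (λ x → bca (δ x a) (δ x b) (δ x c)) (p , q) (s , r)
      where
      bca : ∀ k l m → l + m + k ≡ k + l + m
      bca = solve-∀
    choose (inj₂ (inj₂ (p , q))) (inj₂ (inj₁ (r , s))) =
      build c b a (b≢c ∘ sym , a≢c ∘ sym , a≢b ∘ sym) (λ x → cba (δ x a) (δ x b) (δ x c)) (q , p) (s , r)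
      where
      cba : ∀ k l m → m + l + k ≡ k + l + m
      cba = solve-∀
    choose (inj₂ (inj₂ p)) (inj₂ (inj₂ q)) = thrice b≢c bt ct p q

-- Invariance of incidence counts under injections

module Embed {A B : Set} (_≟ᴬ_ : DecidableEquality A) (_≟ᴮ_ : DecidableEquality B)
             (h : A → B) (h-injective : ∀ {x y} → h x ≡ h y → x ≡ y) where
  private
    module A = Incidence _≟ᴬ_
    module B = Incidence _≟ᴮ_

  δ-map : ∀ x y → B.δ (h x) (h y) ≡ A.δ x y
  δ-map x y with x ≟ᴬ y
  ... | yes refl = B.δ-refl (h x)
  ... | no x≢y   = B.δ-≢ (x≢y ∘ h-injective)

  mem-map : ∀ x t → B.mem (h x) (mapTriple h t) ≡ A.mem x t
  mem-map x (a , b , c) = cong₂ _+_ (cong₂ _+_ (δ-map x a) (δ-map x b)) (δ-map x c)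

  common-map : ∀ t u → B.common (mapTriple h t) (mapTriple h u) ≡ A.common t u
  common-map (a , b , c) u = cong₂ _+_ (cong₂ _+_ (mem-map a u) (mem-map b u)) (mem-map c u)

  cov-map : ∀ p q t → B.cov (h p) (h q) (mapTriple h t) ≡ A.cov p q t
  cov-map p q t = cong₂ _*_ (mem-map p t) (mem-map q t)

  cover-map : ∀ p q ts → B.cover (h p) (h q) (map (mapTriple h) ts) ≡ A.cover p q ts
  cover-map p q ts = cong sum (trans (sym (map-∘ ts)) (map-cong (cov-map p q) ts))

  distinct-map : ∀ {ts} → All Distinct ts → All Distinct (map (mapTriple h) ts)
  distinct-map ds = All.map⁺ (All.map (λ { (x , y , z) → x ∘ h-injective , y ∘ h-injective , z ∘ h-injective }) ds)

  path-map : ∀ {a b ts} → Path A.Adjacent a b ts → Path B.Adjacent (mapTriple h a) (mapTriple h b) (map (mapTriple h) ts)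
  path-map = mapPath (mapTriple h) (λ {t} {u} e → B.adjacent (trans (common-map t u) (A.common≡2 e)))

module _ {n : ℕ} where
  open Incidence (Fin._≟_ {n}) public

GrayCode-Fin : ℕ → Set
GrayCode-Fin n = Incidence.GrayCode (Fin._≟_ {n})

-- Subsets compared with ordered triples

∑-zero : ∀ {n} {f : Fin n → ℕ} → (∀ x → f x ≡ 0) → ∑ f ≡ 0
∑-zero {n} f≡0 = trans (sum-cong-≗ f≡0) (sum-replicate-zero n)

∑-δ : ∀ {n} (a : Fin n) (g : Fin n → ℕ) → ∑[ x < n ] (δ x a * g x) ≡ g a
∑-δ {suc n} zero g = trans (cong₂ _+_ (*-identityˡ (g zero)) (∑-zero {n} {λ _ → 0} (λ _ → refl))) (+-identityʳ _)
∑-δ {suc n} (suc a) g = ∑-δ a (g ∘ suc)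

∑-mem : ∀ {n} (t : Triple (Fin n)) (g : Fin n → ℕ) → let (a , b , c) = t in
        ∑[ x < n ] (mem x t * g x) ≡ g a + g b + g c
∑-mem {n} (a , b , c) g = begin
  ∑[ x < n ] ((δ x a + δ x b + δ x c) * g x)
    ≡⟨ sum-cong-≗ (λ x → trans (*-distribʳ-+ (g x) (δ x a + δ x b) (δ x c)) (cong (_+ δ x c * g x) (*-distribʳ-+ (g x) (δ x a) (δ x b)))) ⟩
  ∑[ x < n ] (δ x a * g x + δ x b * g x + δ x c * g x)
    ≡⟨ ∑-distrib-+ (λ x → δ x a * g x + δ x b * g x) (λ x → δ x c * g x) ⟩
  ∑[ x < n ] (δ x a * g x + δ x b * g x) + ∑[ x < n ] (δ x c * g x)
    ≡⟨ cong (_+ ∑[ x < n ] (δ x c * g x)) (∑-distrib-+ (λ x → δ x a * g x) (λ x → δ x b * g x)) ⟩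
  ∑[ x < n ] (δ x a * g x) + ∑[ x < n ] (δ x b * g x) + ∑[ x < n ] (δ x c * g x)
    ≡⟨ cong₂ _+_ (cong₂ _+_ (∑-δ a g) (∑-δ b g)) (∑-δ c g) ⟩
  g a + g b + g c ∎
  where open ≡-Reasoning

_∋_ : ∀ {n} → Subset n → Fin n → ℕ
B ∋ x = ind (Vec.lookup B x)

∣∣≡∑ : ∀ {n} (B : Subset n) → ∣ B ∣ ≡ ∑[ x < n ] (B ∋ x)
∣∣≡∑ []            = refl
∣∣≡∑ (inside ∷ B)  = cong suc (∣∣≡∑ B)
∣∣≡∑ (outside ∷ B) = ∣∣≡∑ B

ind-∧ : ∀ a b → ind (a ∧ b) ≡ ind a * ind b
ind-∧ true  b = sym (+-identityʳ (ind b))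
ind-∧ false b = refl

∩-∋ : ∀ {n} (B C : Subset n) x → (B ∩ C) ∋ x ≡ (B ∋ x) * (C ∋ x)
∩-∋ B C x = trans (cong ind (Vec.lookup-zipWith _∧_ x B C)) (ind-∧ (Vec.lookup B x) _)

_≐_ : ∀ {n} → Subset n → Triple (Fin n) → Set
B ≐ t = ∀ x → B ∋ x ≡ mem x t

∣∩∣≡common : ∀ {n} (B C : Subset n) {t u} → B ≐ t → C ≐ u → ∣ B ∩ C ∣ ≡ common t u
∣∩∣≡common {n} B C {t} {u} B≐t C≐u = begin
  ∣ B ∩ C ∣                        ≡⟨ ∣∣≡∑ (B ∩ C) ⟩
  ∑[ x < n ] ((B ∩ C) ∋ x)         ≡⟨ sum-cong-≗ (λ x → trans (∩-∋ B C x) (cong₂ _*_ (B≐t x) (C≐u x))) ⟩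
  ∑[ x < n ] (mem x t * mem x u)   ≡⟨ ∑-mem t (λ x → mem x u) ⟩
  common t u                       ∎
  where open ≡-Reasoning

∣∣≡3 : ∀ {n} (B : Subset n) {t} → B ≐ t → ∣ B ∣ ≡ 3
∣∣≡3 {n} B {t} B≐t = begin
  ∣ B ∣                      ≡⟨ ∣∣≡∑ B ⟩
  ∑[ x < n ] (B ∋ x)         ≡⟨ sum-cong-≗ (λ x → trans (B≐t x) (sym (*-identityʳ _))) ⟩
  ∑[ x < n ] (mem x t * 1)   ≡⟨ ∑-mem t (λ _ → 1) ⟩
  3                          ∎
  where open ≡-Reasoning

toSubset : ∀ {n} → Triple (Fin n) → Subset n
toSubset (a , b , c) = Vec.tabulate λ x → does (x Fin.≟ a) ∨ does (x Fin.≟ b) ∨ does (x Fin.≟ c)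

toSubset-≐ : ∀ {n} {t : Triple (Fin n)} → Distinct t → toSubset t ≐ t
toSubset-≐ {t = a , b , c} (a≢b , a≢c , b≢c) x
  rewrite Vec.lookup∘tabulate (λ x → does (x Fin.≟ a) ∨ does (x Fin.≟ b) ∨ does (x Fin.≟ c)) x
  with x Fin.≟ a | x Fin.≟ b | x Fin.≟ c
... | yes refl | yes refl | _        = contradiction refl a≢b
... | yes refl | no _     | yes refl = contradiction refl a≢c
... | yes _    | no _     | no _     = refl
... | no _     | yes refl | yes refl = contradiction refl b≢c
... | no _     | yes _    | no _     = refl
... | no _     | no _     | yes _    = refl
... | no _     | no _     | no _     = refl

elements : ∀ {n} → Subset n → List (Fin n)
elements []            = []
elements (inside ∷ B)  = zero ∷ map suc (elements B)
elements (outside ∷ B) = map suc (elements B)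

length-elements : ∀ {n} (B : Subset n) → length (elements B) ≡ ∣ B ∣
length-elements []            = refl
length-elements (inside ∷ B)  = cong suc (trans (length-map suc (elements B)) (length-elements B))
length-elements (outside ∷ B) = trans (length-map suc (elements B)) (length-elements B)

δ-zero-suc : ∀ {n} (xs : List (Fin n)) → sum (map (δ zero) (map suc xs)) ≡ 0
δ-zero-suc []       = refl
δ-zero-suc (_ ∷ xs) = δ-zero-suc xs

∋-elements : ∀ {n} (B : Subset n) x → B ∋ x ≡ sum (map (δ x) (elements B))
∋-elements (inside ∷ B) zero     = cong suc (sym (δ-zero-suc (elements B)))
∋-elements (outside ∷ B) zero    = sym (δ-zero-suc (elements B))
∋-elements (inside ∷ B) (suc x)  = trans (∋-elements B x) (cong sum (map-∘ (elements B)))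
∋-elements (outside ∷ B) (suc x) = trans (∋-elements B x) (cong sum (map-∘ (elements B)))

-- The listed elements are distinct because a repeated one would be counted twice, while an
-- indicator is at most 1. `tripleOf` argues in the same way.
pairOf : ∀ {n} (P : Subset n) → ∣ P ∣ ≡ 2 → ∃[ p ] ∃[ q ] p ≢ q × (∀ x → P ∋ x ≡ δ x p + δ x q)
pairOf P ∣P∣≡2 with elements P | length-elements P | ∋-elements P
... | []                | l | _ = contradiction (trans l ∣P∣≡2) λ ()
... | _ ∷ []            | l | _ = contradiction (trans l ∣P∣≡2) λ ()
... | _ ∷ _ ∷ _ ∷ _     | l | _ = contradiction (trans l ∣P∣≡2) λ ()
... | p ∷ q ∷ []        | _ | e = p , q , p≢q , λ x → trans (e x) (cong (δ x p +_) (+-identityʳ _))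
  where
  p≢q : p ≢ q
  p≢q refl with s≤s () ← subst (_≤ 1) (trans (e p) (cong (λ k → k + (k + 0)) (δ-refl p))) (ind≤1 (Vec.lookup P p))

tripleOf : ∀ {n} (B : Subset n) → ∣ B ∣ ≡ 3 → Σ[ t ∈ Triple (Fin n) ] Distinct t × B ≐ t
tripleOf B ∣B∣≡3 with elements B | length-elements B | ∋-elements B
... | []                  | l | _ = contradiction (trans l ∣B∣≡3) λ ()
... | _ ∷ []              | l | _ = contradiction (trans l ∣B∣≡3) λ ()
... | _ ∷ _ ∷ []          | l | _ = contradiction (trans l ∣B∣≡3) λ ()
... | _ ∷ _ ∷ _ ∷ _ ∷ _   | l | _ = contradiction (trans l ∣B∣≡3) λ ()
... | a ∷ b ∷ c ∷ []      | _ | e = (a , b , c) , (a≢b , a≢c , b≢c) , B≐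
  where
  B≐ : B ≐ (a , b , c)
  B≐ x = trans (e x) (trans (cong (λ k → δ x a + (δ x b + k)) (+-identityʳ _)) (sym (+-assoc (δ x a) _ _)))
  atMost1 : ∀ x → mem x (a , b , c) ≤ 1
  atMost1 x = subst (_≤ 1) (B≐ x) (ind≤1 (Vec.lookup B x))
  a≢b : a ≢ b
  a≢b refl with s≤s () ← subst (_≤ 1) (cong (λ k → k + k + δ a c) (δ-refl a)) (atMost1 a)
  a≢c : a ≢ c
  a≢c refl with s≤s p ← subst (_≤ 1) (cong (λ k → k + δ a b + k) (δ-refl a)) (atMost1 a)
    = contradiction (≤-trans (m≤n+m 1 _) p) λ ()
  b≢c : b ≢ c
  b≢c refl with m≤n+m 2 (δ b a) | subst (_≤ 1) (cong (λ k → δ b a + k + k) (δ-refl b)) (atMost1 b)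
  ... | u | w with s≤s () ← ≤-trans u (≤-trans (≤-reflexive (sym (+-assoc (δ b a) 1 1))) w)

∋≡1⇒∈ : ∀ {n} (B : Subset n) {x} → B ∋ x ≡ 1 → x Subset.∈ B
∋≡1⇒∈ B {x} e with Vec.lookup B x in eq
... | true = Vec.lookup⇒[]= x B eq

∈⇒∋≡1 : ∀ {n} {B : Subset n} {x} → x Subset.∈ B → B ∋ x ≡ 1
∈⇒∋≡1 x∈B = cong ind (Vec.[]=⇒lookup x∈B)

module _ {n} (P : Subset n) {p q} (P≐ : ∀ x → P ∋ x ≡ δ x p + δ x q) (p≢q : p ≢ q) where

  -- The bridge between the two forms of balance: a `TTS` counts blocks by inclusion, a Gray code by
  -- products of indicators.
  ⊆-indicator : ∀ B → ind (does (P ⊆? B)) ≡ (B ∋ p) * (B ∋ q)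
  ⊆-indicator B with P ⊆? B
  ... | yes P⊆B = sym (cong₂ _*_ (∈⇒∋≡1 (P⊆B (∋≡1⇒∈ P Pp))) (∈⇒∋≡1 (P⊆B (∋≡1⇒∈ P Pq))))
    where
    Pp : P ∋ p ≡ 1
    Pp = trans (P≐ p) (cong₂ _+_ (δ-refl p) (δ-≢ p≢q))
    Pq : P ∋ q ≡ 1
    Pq = trans (P≐ q) (cong₂ _+_ (δ-≢ (p≢q ∘ sym)) (δ-refl q))
  ... | no P⊈B with Vec.lookup B p in eqp | Vec.lookup B q in eqq
  ... | false | _     = refl
  ... | true  | false = refl
  ... | true  | true  = ⊥-elim (P⊈B P⊆B)
    where
    P⊆B : P ⊆ B
    P⊆B {x} x∈P with x Fin.≟ p | x Fin.≟ q | trans (sym (P≐ x)) (∈⇒∋≡1 x∈P)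
    ... | yes refl | _        | _ = Vec.lookup⇒[]= _ B eqp
    ... | no _     | yes refl | _ = Vec.lookup⇒[]= _ B eqq

length-filter : ∀ {A : Set} {P : A → Set} (P? : Decidable P) xs → length (filter P? xs) ≡ sum (map (ind ∘ does ∘ P?) xs)
length-filter P? []       = refl
length-filter P? (x ∷ xs) with does (P? x)
... | true  = cong suc (length-filter P? xs)
... | false = length-filter P? xs

pairSubset : ∀ {n} → Fin n → Fin n → Subset n
pairSubset p q = Vec.tabulate λ x → does (x Fin.≟ p) ∨ does (x Fin.≟ q)

pairSubset-∋ : ∀ {n} {p q : Fin n} → p ≢ q → ∀ x → pairSubset p q ∋ x ≡ δ x p + δ x q
pairSubset-∋ {p = p} {q} p≢q x
  rewrite Vec.lookup∘tabulate (λ x → does (x Fin.≟ p) ∨ does (x Fin.≟ q)) x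
  with x Fin.≟ p | x Fin.≟ q
... | yes refl | yes refl = contradiction refl p≢q
... | yes _    | no _     = refl
... | no _     | yes _    = refl
... | no _     | no _     = refl

∣pairSubset∣≡2 : ∀ {n} {p q : Fin n} → p ≢ q → ∣ pairSubset p q ∣ ≡ 2
∣pairSubset∣≡2 {n} {p} {q} p≢q = begin
  ∣ pairSubset p q ∣                             ≡⟨ ∣∣≡∑ (pairSubset p q) ⟩
  ∑[ x < n ] (pairSubset p q ∋ x)                ≡⟨ sum-cong-≗ (λ x → trans (pairSubset-∋ p≢q x) (sym (cong₂ _+_ (*-identityʳ (δ x p)) (*-identityʳ (δ x q))))) ⟩
  ∑[ x < n ] (δ x p * 1 + δ x q * 1)             ≡⟨ ∑-distrib-+ (λ x → δ x p * 1) (λ x → δ x q * 1) ⟩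
  ∑[ x < n ] (δ x p * 1) + ∑[ x < n ] (δ x q * 1) ≡⟨ cong₂ _+_ (∑-δ p (λ _ → 1)) (∑-δ q (λ _ → 1)) ⟩
  2                                              ∎
  where open ≡-Reasoning

map-congAll : ∀ {A B : Set} {P : A → Set} {f g : A → B} → (∀ {x} → P x → f x ≡ g x) →
              ∀ {xs} → All P xs → map f xs ≡ map g xs
map-congAll h []        = refl
map-congAll h (px ∷ ps) = cong₂ _∷_ (h px) (map-congAll h ps)

lookup-allFin : ∀ {A : Set} (xs : List A) → map (lookup xs) (allFin (length xs)) ≡ xs
lookup-allFin xs = trans (map-tabulate id (lookup xs)) (tabulate-lookup xs)

-- Hamiltonian designs and Gray codes

-- With the blocks listed in cyclic order, the Hamilton cycle is 0, 1, 2, ... in the positions,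
-- which are distinct and exhaust all vertices.
fromGrayCode : ∀ {n} → GrayCode-Fin n → Σ[ D ∈ TTS n ] Hamiltonian (2-BIG D)
fromGrayCode {n} record {final = final ; triples = t ∷ ts ; path = path ; closes = closes; long = long; distinct = distinct; balanced = bal} = D , record
  { start    = zero
  ; rest     = tabulate suc
  ; long     = subst (3 ≤_) (cong suc (sym (trans (length-tabulate Fin.suc) (length-map toSubset ts)))) long
  ; distinct = Unique.allFin⁺ _
  ; closed   = Linked.map⁻ (subst (Linked _) (sym closed-eq) linked)
  ; spanning = ∈-allFin
  }
  where
  blocks = map toSubset (t ∷ ts)
  D : TTS n
  D = record
    { blocks     = blocks
    ; block-size = All.map⁺ (All.map (λ {u} d → ∣∣≡3 (toSubset u) (toSubset-≐ d)) distinct)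
    ; balanced   = λ P ∣P∣≡2 → let p , q , p≢q , P≐ = pairOf P ∣P∣≡2 in begin
        length (filter (P ⊆?_) blocks)                           ≡⟨ length-filter (P ⊆?_) blocks ⟩
        sum (map (ind ∘ does ∘ (P ⊆?_)) blocks)                  ≡⟨ cong sum (sym (map-∘ (t ∷ ts))) ⟩
        sum (map (λ u → ind (does (P ⊆? toSubset u))) (t ∷ ts))  ≡⟨ cong sum (map-congAll (λ {u} d → trans (⊆-indicator P P≐ p≢q (toSubset u)) (cong₂ _*_ (toSubset-≐ d p) (toSubset-≐ d q))) distinct) ⟩
        cover p q (t ∷ ts)                                       ≡⟨ bal p≢q ⟩
        2                                                        ∎
    }
    where open ≡-Reasoning
  closed-eq : map (lookup blocks) (zero ∷ (tabulate suc ∷ʳ zero)) ≡ blocks ∷ʳ toSubset t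
  closed-eq = cong (toSubset t ∷_) (trans (map-++ (lookup blocks) (tabulate suc) [ zero ])
    (cong (_∷ʳ toSubset t) (trans (map-tabulate suc (lookup blocks)) (tabulate-lookup (map toSubset ts)))))
  ∣∩∣≡2 : Rel (Subset n) 0ℓ
  ∣∩∣≡2 B C = ∣ B ∩ C ∣ ≡ 2
  linked : Linked ∣∩∣≡2 (blocks ∷ʳ toSubset t)
  linked = path⇒linked (subst (λ a → Path ∣∩∣≡2 (toSubset a) (toSubset final) blocks) (path-start path)
      (mapPath toSubset intersect (restrict distinct path)))
    (intersect (all-final distinct path , All.head distinct , subst (Adjacent final) (path-start path) closes))
    where
    intersect : ∀ {u w} → Distinct u × Distinct w × Adjacent u w → ∣ toSubset u ∩ toSubset w ∣ ≡ 2
    intersect {u} {w} (du , dw , adj) = trans (∣∩∣≡common (toSubset u) (toSubset w) (toSubset-≐ du) (toSubset-≐ dw)) (common≡2 adj)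

-- The cycle lists positions without repetition and reaches all of them, so it is a permutation of
-- all positions. Hence sums over the cycle agree with sums over the block list, repeated blocks
-- included.
toGrayCode : ∀ {n} → Σ[ D ∈ TTS n ] Hamiltonian (2-BIG D) → GrayCode-Fin n
toGrayCode {n} (D , H) = record
  { triples  = map triple L
  ; path     = mapPath triple (λ {i} {j} e → adjacent (trans (sym (∣∩∣≡common (lookup blocks i) (lookup blocks j) (triple-≐ i) (triple-≐ j))) e)) (proj₁ (proj₂ cycle))
  ; closes   = adjacent (trans (sym (∣∩∣≡common (lookup blocks (proj₁ cycle)) (lookup blocks start) (triple-≐ (proj₁ cycle)) (triple-≐ start))) (proj₂ (proj₂ cycle)))
  ; long     = subst (3 ≤_) (sym (length-map triple L)) long
  ; distinct = All.map⁺ (All.universal (λ i → proj₁ (proj₂ (spec i))) L)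
  ; balanced = λ {p} {q} p≢q → begin
      cover p q (map triple L)                                        ≡⟨ cong sum (sym (map-∘ L)) ⟩
      sum (map (cov p q ∘ triple) L)                                  ≡⟨ sum-↭ (Perm.map⁺ (cov p q ∘ triple) L↭) ⟩
      sum (map (cov p q ∘ triple) (allFin _))                         ≡⟨ cong sum (map-cong (λ i → sym (trans (⊆-indicator (pairSubset p q) (pairSubset-∋ p≢q) p≢q (lookup blocks i)) (cong₂ _*_ (triple-≐ i p) (triple-≐ i q)))) (allFin _)) ⟩
      sum (map (f p q ∘ lookup blocks) (allFin _))               ≡⟨ cong sum (trans (map-∘ (allFin _)) (cong (map (f p q)) (lookup-allFin blocks))) ⟩
      sum (map (f p q) blocks)                                   ≡⟨ length-filter (pairSubset p q ⊆?_) blocks ⟨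
      length (filter (pairSubset p q ⊆?_) blocks)                ≡⟨ balanced (pairSubset p q) (∣pairSubset∣≡2 p≢q) ⟩
      2                                                          ∎
  }
  where
  open TTS D
  open HamiltonCycle H
  open ≡-Reasoning
  L = start ∷ rest
  spec : ∀ i → Σ[ t ∈ Triple (Fin n) ] Distinct t × lookup blocks i ≐ t
  spec i = tripleOf (lookup blocks i) (All.lookup block-size (∈-lookup {xs = blocks} i))
  triple : Fin (length blocks) → Triple (Fin n)
  triple i = proj₁ (spec i)
  triple-≐ : ∀ i → lookup blocks i ≐ triple i
  triple-≐ i = proj₂ (proj₂ (spec i))
  cycle = linked⇒path rest closed
  L↭ : L ↭ allFin (length blocks)
  L↭ = ∼bag⇒↭ (unique∧set⇒bag distinct (Unique.allFin⁺ _) (λ {i} → mk⇔ (λ _ → ∈-allFin i) (λ _ → spanning i)))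
  f : Fin n → Fin n → Subset n → ℕ
  f p q B = ind (does (pairSubset p q ⊆? B))

-- Placing the removed block by a permutation

module _ {n : ℕ} where

  transpose-source : ∀ (i j : Fin n) → transpose i j ⟨$⟩ʳ i ≡ j
  transpose-source i j rewrite dec-true (i Fin.≟ i) refl = refl

  transpose-fixed : ∀ {i j k : Fin n} → k ≢ i → k ≢ j → transpose i j ⟨$⟩ʳ k ≡ k
  transpose-fixed {i} {j} {k} k≢i k≢j rewrite dec-false (k Fin.≟ i) k≢i | dec-false (k Fin.≟ j) k≢j = refl

  permutation-injective : ∀ (π : Permutation′ n) {x y} → π ⟨$⟩ʳ x ≡ π ⟨$⟩ʳ y → x ≡ y
  permutation-injective π e = trans (sym (inverseˡ π)) (trans (cong (π ⟨$⟩ˡ_) e) (inverseˡ π))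

  -- Three transpositions, each bringing one more point to its target. A target already reached
  -- stays fixed, since it differs from the current image of the next point and from its target.
  three-transitive : ∀ {e f g e′ f′ g′ : Fin n} → Distinct (e , f , g) → Distinct (e′ , f′ , g′) →
    Σ[ π ∈ Permutation′ n ] (π ⟨$⟩ʳ e ≡ e′ × π ⟨$⟩ʳ f ≡ f′ × π ⟨$⟩ʳ g ≡ g′)
  three-transitive {e} {f} {g} {e′} {f′} {g′} (e≢f , e≢g , f≢g) (e′≢f′ , e′≢g′ , f′≢g′) =
    π₂ ∘ₚ π₃ , trans (cong (π₃ ⟨$⟩ʳ_) e₂) (transpose-fixed e′≢g₂ e′≢g′)
             , trans (cong (π₃ ⟨$⟩ʳ_) f₂) (transpose-fixed f′≢g₂ f′≢g′)
             , transpose-source g₂ g′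
    where
    π₁ = transpose e e′
    f₁ = π₁ ⟨$⟩ʳ f
    π₂ = π₁ ∘ₚ transpose f₁ f′
    g₂ = π₂ ⟨$⟩ʳ g
    π₃ = transpose g₂ g′
    e′≢f₁ : e′ ≢ f₁
    e′≢f₁ p = e≢f (permutation-injective π₁ (trans (transpose-source e e′) p))
    e₂ : π₂ ⟨$⟩ʳ e ≡ e′
    e₂ = trans (cong (transpose f₁ f′ ⟨$⟩ʳ_) (transpose-source e e′)) (transpose-fixed e′≢f₁ e′≢f′)
    f₂ : π₂ ⟨$⟩ʳ f ≡ f′
    f₂ = transpose-source f₁ f′
    e′≢g₂ : e′ ≢ g₂
    e′≢g₂ p = e≢g (permutation-injective π₂ (trans e₂ p))
    f′≢g₂ : f′ ≢ g₂
    f′≢g₂ p = f≢g (permutation-injective π₂ (trans f₂ p))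

  relabel : ∀ (π : Permutation′ n) {e f g} → CutCode e f g →
            CutCode (π ⟨$⟩ʳ e) (π ⟨$⟩ʳ f) (π ⟨$⟩ʳ g)
  relabel π {e} {f} {g} C = record
    { path     = path-map path
    ; distinct = distinct-map distinct
    ; balanced = λ {p} {q} p≢q → subst₂
        (λ p q → cover p q (map (mapTriple (π ⟨$⟩ʳ_)) triples) + cov p q (mapTriple (π ⟨$⟩ʳ_) (e , f , g)) ≡ 2)
        (inverseʳ π) (inverseʳ π)
        (trans (cong₂ _+_ (cover-map (π ⟨$⟩ˡ p) (π ⟨$⟩ˡ q) triples) (cov-map (π ⟨$⟩ˡ p) (π ⟨$⟩ˡ q) (e , f , g)))
          (balanced (λ eq → p≢q (trans (sym (inverseʳ π)) (trans (cong (π ⟨$⟩ʳ_) eq) (inverseʳ π))))))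
    ; e∈first  = trans (mem-map e _) e∈first
    ; f∈first  = trans (mem-map f _) f∈first
    ; e∈final  = trans (mem-map e _) e∈final
    ; g∈final  = trans (mem-map g _) g∈final
    }
    where
    open CutCode C
    open Embed Fin._≟_ Fin._≟_ (π ⟨$⟩ʳ_) (permutation-injective π)

  cut-at : GrayCode-Fin n → ∀ {e f g} → Distinct (e , f , g) → CutCode e f g
  cut-at G d with cut G
  ... | _ , _ , _ , d′ , C with three-transitive d′ d
  ... | π , refl , refl , refl = relabel π C

-- Residues modulo v and sums over a full period

∑-last : ∀ m (f : ℕ → ℕ) → ∑[ i < suc m ] f (toℕ i) ≡ ∑[ i < m ] f (toℕ i) + f m
∑-last zero    f = +-comm (f 0) 0
∑-last (suc m) f = trans (cong (f 0 +_) (∑-last m (f ∘ suc))) (sym (+-assoc (f 0) _ _))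

module Cyclic (v : ℕ) .{{_ : ℕ.NonZero v}} where

  [_]ᵥ : ℕ → Fin v
  [ k ]ᵥ = k mod v

  periodic : ∀ k → [ k + v ]ᵥ ≡ [ k ]ᵥ
  periodic k = fromℕ<-cong _ _ ([m+n]%n≡m%n k v) (m%n<n (k + v) v) (m%n<n k v)

  [toℕ]ᵥ : ∀ i → [ toℕ i ]ᵥ ≡ i
  [toℕ]ᵥ i = trans (fromℕ<-cong _ _ (m<n⇒m%n≡m (toℕ<n i)) _ (toℕ<n i)) (fromℕ<-toℕ i (toℕ<n i))

  -- Equal remainders would make v divide the difference, which lies strictly between 0 and v.
  []ᵥ-≢ : ∀ k {d} → suc d < v → [ k ]ᵥ ≢ [ k + suc d ]ᵥ
  []ᵥ-≢ k {d} d<v eq = <⇒≱ d<v (∣⇒≤ v∣d)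
    where
    open ≡-Reasoning
    mods : k % v ≡ (k + suc d) % v
    mods = trans (sym (toℕ-fromℕ< (m%n<n k v))) (trans (cong toℕ eq) (toℕ-fromℕ< (m%n<n (k + suc d) v)))
    v∣d : v ∣ suc d
    v∣d = ∣m+n∣m⇒∣n {m = (k / v) * v} (divides ((k + suc d) / v) (+-cancelˡ-≡ (k % v) _ _ (begin
      k % v + ((k / v) * v + suc d)                     ≡⟨ +-assoc (k % v) _ _ ⟨
      k % v + (k / v) * v + suc d                       ≡⟨ cong (_+ suc d) (m≡m%n+[m/n]*n k v) ⟨
      k + suc d                                         ≡⟨ m≡m%n+[m/n]*n (k + suc d) v ⟩
      (k + suc d) % v + ((k + suc d) / v) * v           ≡⟨ cong (_+ ((k + suc d) / v) * v) mods ⟨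
      k % v + ((k + suc d) / v) * v                     ∎))) (divides (k / v) refl)

  []ᵥ-distinct : ∀ {k l} → k < l → l < k + v → [ k ]ᵥ ≢ [ l ]ᵥ
  []ᵥ-distinct {k} k<l l<k+v with d , refl ← m≤n⇒∃[o]m+o≡n k<l =
    subst (λ m → [ k ]ᵥ ≢ [ m ]ᵥ) (+-suc k d) ([]ᵥ-≢ k (+-cancelˡ-< k _ _ (subst (_< k + v) (sym (+-suc k d)) l<k+v)))

  -- Moving the start from d to d + 1 drops the term at d and adds the term at d + v, and these are
  -- equal.
  ∑-shift : ∀ (f : Fin v → ℕ) d → ∑[ y < v ] f [ d + toℕ y ]ᵥ ≡ ∑[ y < v ] f [ toℕ y ]ᵥ
  ∑-shift f zero    = refl
  ∑-shift f (suc d) = trans (+-cancelˡ-≡ (f [ d ]ᵥ) _ _ (begin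
      f [ d ]ᵥ + ∑[ y < v ] f [ suc (d + toℕ y) ]ᵥ           ≡⟨ cong₂ _+_ (cong (λ k → f [ k ]ᵥ) (sym (+-identityʳ d))) (sum-cong-≗ {v} (λ y → cong (λ k → f [ k ]ᵥ) (sym (+-suc d (toℕ y))))) ⟩
      ∑[ y < suc v ] f [ d + toℕ y ]ᵥ                        ≡⟨ ∑-last v (λ k → f [ d + k ]ᵥ) ⟩
      ∑[ y < v ] f [ d + toℕ y ]ᵥ + f [ d + v ]ᵥ             ≡⟨ cong (λ i → ∑[ y < v ] f [ d + toℕ y ]ᵥ + f i) (periodic d) ⟩
      ∑[ y < v ] f [ d + toℕ y ]ᵥ + f [ d ]ᵥ                 ≡⟨ +-comm (∑[ y < v ] f [ d + toℕ y ]ᵥ) _ ⟩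
      f [ d ]ᵥ + ∑[ y < v ] f [ d + toℕ y ]ᵥ                 ∎)) (∑-shift f d)
    where open ≡-Reasoning

  ∑-hit : ∀ j d → ∑[ y < v ] δ j [ d + toℕ y ]ᵥ ≡ 1
  ∑-hit j d = trans (∑-shift (δ j) d) (trans
    (sum-cong-≗ (λ y → trans (cong (δ j) ([toℕ]ᵥ y)) (trans (δ-sym j y) (sym (*-identityʳ (δ y j))))))
    (∑-δ j (λ _ → 1)))

  -- The form in which one Latin square covers a cross pair once: one point fixes the outer index,
  -- and the coordinate of the other then runs through all residues.
  ∑∑-product : ∀ (f : Fin v → ℕ) (g : Fin v → Fin v → ℕ) → ∑ f ≡ 1 → (∀ x → ∑ (g x) ≡ 1) →
               ∑[ x < v ] ∑[ y < v ] (f x * g x y) ≡ 1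
  ∑∑-product f g ∑f ∑g = trans (sum-cong-≗ (λ x → trans (sym (scale (f x) (g x))) (trans (cong (f x *_) (∑g x)) (*-identityʳ (f x))))) ∑f
    where
    scale : ∀ {m} c (h : Fin m → ℕ) → c * ∑ h ≡ ∑[ y < m ] (c * h y)
    scale {zero}  c h = *-zeroʳ c
    scale {suc m} c h = trans (*-distribˡ-+ c (h zero) _) (cong (c * h zero +_) (scale c (h ∘ suc)))

-- Labels: the trade uniformly in v

-- A label (g , k) stands for the point k mod v of the g-th copy of the point
-- set, uniformly in v.  The copies are called rows (ρ), columns (κ) and symbols (σ).
Label : Set
Label = Fin 3 × ℕ

_≟ˡ_ : DecidableEquality Label
_≟ˡ_ = ≡-dec Fin._≟_ ℕ._≟_

module L = Incidence _≟ˡ_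

pattern ρ k = 0F , k
pattern κ k = 1F , k
pattern σ k = 2F , k

-- Two Latin squares of order v, whose symbols in a cell differ by 1.
T₁ T₂ : ℕ → ℕ → Triple Label
T₁ x y = (ρ x , κ y , σ (x + y))
T₂ x y = (ρ x , κ y , σ (suc (x + y)))

-- As v ≥ 4, near labels stand for equal points only if they are equal.
Near : Label → Label → Set
Near (g , k) (h , l) = g ≢ h ⊎ ∣ k - l ∣ ≤ 3

near? : ∀ a b → Dec (Near a b)
near? (g , k) (h , l) = ¬? (g Fin.≟ h) ⊎-dec (∣ k - l ∣ ≤? 3)

AllNear : Label → Triple Label → Set
AllNear x (a , b , c) = Near x a × Near x b × Near x c

allNear? : ∀ x t → Dec (AllNear x t)
allNear? x (a , b , c) = near? x a ×-dec near? x b ×-dec near? x c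

-- All nine pairs of entries are required to be near, so that the count made on labels is also the
-- count on points for every v ≥ 4.
Step : Triple Label → Triple Label → Set
Step t@(a , b , c) u = (AllNear a u × AllNear b u × AllNear c u) × L.common t u ≡ 2

step? : ∀ t u → Dec (Step t u)
step? t@(a , b , c) u = (allNear? a u ×-dec allNear? b u ×-dec allNear? c u) ×-dec (L.common t u ℕ.≟ 2)

Chain : List (Triple Label) → Set
Chain []               = ⊥
Chain (_ ∷ [])         = ⊤
Chain (t ∷ us@(u ∷ _)) = True (step? t u) × Chain us

-- The value at the empty list is junk.
head final : List (Triple Label) → Triple Label
head []       = T₁ 0 0
head (t ∷ _)  = t
final []               = T₁ 0 0
final (t ∷ [])         = t
final (_ ∷ us@(_ ∷ _)) = final us

Proper : Triple Label → Set
Proper t@(a , b , c) = (Near a b × Near a c × Near b c) × Distinct t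

proper? : ∀ t → Dec (Proper t)
proper? t@(a , b , c) = (near? a b ×-dec near? a c ×-dec near? b c) ×-dec (¬? (a ≟ˡ b) ×-dec ¬? (a ≟ˡ c) ×-dec ¬? (b ≟ˡ c))

-- Row x of the two squares is a cycle: `T₁` and `T₂` agree in the cell, then `T₂` and the next `T₁`
-- agree in the symbol. `row` opens it before a `T₂`, `segment` before a `T₁`; the last argument is
-- one less than the number of cells' worth of triples.
row : ℕ → ℕ → ℕ → List (Triple Label)
row x y zero    = T₂ x y ∷ T₁ x (suc y) ∷ []
row x y (suc m) = T₂ x y ∷ T₁ x (suc y) ∷ row x (suc y) m

segment : ℕ → ℕ → ℕ → List (Triple Label)
segment x y zero    = T₁ x y ∷ T₂ x y ∷ []
segment x y (suc m) = T₁ x y ∷ T₂ x y ∷ segment x (suc y) m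

-- The rows 3 + k, ..., 3 in descending order; rows 0, 1 and 2 meet the trade and are treated apart.
rows : ℕ → ℕ → List (Triple Label)
rows m zero    = row 3 1 m
rows m (suc k) = row (4 + k) 1 m ++ rows m k

-- Found by computer search.  These triples replace oldTriples below: six of
-- the eighteen Latin square triples and the blocks Bʳ, Bᶜ, Bˢ are exchanged for
-- nine triples with two points in one copy and one in another.
A₁ A₂ A₃ A₄ A₅ A₆ A₇ : List (Triple Label)
A₁ = T₂ 2 1 ∷ T₁ 2 2 ∷ T₂ 2 2 ∷ T₁ 2 3 ∷ T₂ 2 3 ∷ []
A₂ = (ρ 1 , ρ 2 , σ 3) ∷ (ρ 0 , ρ 1 , σ 3) ∷ []
A₃ = (ρ 0 , ρ 2 , κ 1) ∷ (ρ 0 , κ 1 , κ 3) ∷ T₂ 0 3 ∷ []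
A₄ = (ρ 0 , σ 1 , σ 2) ∷ T₁ 0 2 ∷ T₂ 0 2 ∷ (κ 2 , κ 3 , σ 3) ∷ []
A₅ = (κ 2 , κ 1 , ρ 1) ∷ T₂ 1 2 ∷ T₁ 1 3 ∷ T₂ 1 3 ∷ []
A₆ = T₁ 1 1 ∷ (σ 3 , σ 2 , κ 1) ∷ []
A₇ = (σ 3 , σ 1 , κ 1) ∷ []

square : ℕ → List (Triple Label)
square x = T₁ x 1 ∷ T₂ x 1 ∷ T₁ x 2 ∷ T₂ x 2 ∷ T₁ x 3 ∷ T₂ x 3 ∷ []

-- The order of the points is that of `CutCode`: the first lies in both ends of the opened cycle,
-- the second in its first block, the third in its last. The new triples on the first two points and
-- on the first and third are the links into and out of the copy.
Bʳ Bᶜ Bˢ : Triple Label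
Bʳ = (ρ 0 , ρ 1 , ρ 2)
Bᶜ = (κ 2 , κ 3 , κ 1)
Bˢ = (σ 3 , σ 2 , σ 1)

edges : Triple Label → List (Label × Label)
edges (a , b , c) = (a , b) ∷ (a , c) ∷ (b , c) ∷ []

-- Comparing multisets of unordered pairs by evaluation

module Matching {A : Set} (_≟_ : DecidableEquality A) where

  sameEdge : A × A → A × A → Bool
  sameEdge (a , b) (c , d) = (does (a ≟ c) ∧ does (b ≟ d)) ∨ (does (a ≟ d) ∧ does (b ≟ c))

  extract : A × A → List (A × A) → Maybe (List (A × A))
  extract e []       = nothing
  extract e (f ∷ fs) = if sameEdge e f then just fs else Maybe.map (f ∷_) (extract e fs)

  matched : List (A × A) → List (A × A) → Bool
  matched []       []      = true
  matched []       (_ ∷ _) = false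
  matched (e ∷ es) fs      = Maybe.maybe′ (matched es) false (extract e fs)

  module _ (w : A × A → ℕ) (w-sym : ∀ a b → w (a , b) ≡ w (b , a)) where

    sameEdge-sound : ∀ e f → T (sameEdge e f) → w e ≡ w f
    sameEdge-sound (a , b) (c , d) p with a ≟ c | b ≟ d | a ≟ d | b ≟ c
    ... | yes refl | yes refl | _        | _        = refl
    ... | yes refl | no _     | yes refl | yes refl = refl
    ... | no _     | _        | yes refl | yes refl = w-sym a b

    extract-sound : ∀ e fs {fs′} → extract e fs ≡ just fs′ → sum (map w fs) ≡ w e + sum (map w fs′)
    extract-sound e (f ∷ fs) p with sameEdge e f in eq
    extract-sound e (f ∷ fs) refl | true = cong (_+ sum (map w fs)) (sym (sameEdge-sound e f (subst T (sym eq) _)))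
    ... | false with extract e fs in eq′ | p
    ... | just gs | refl = trans (cong (w f +_) (extract-sound e fs eq′)) (exchange (w f) (w e) _)
      where
      exchange : ∀ k l m → k + (l + m) ≡ l + (k + m)
      exchange = solve-∀

    matched-sound : ∀ es fs → T (matched es fs) → sum (map w es) ≡ sum (map w fs)
    matched-sound []       []  _ = refl
    matched-sound (e ∷ es) fs p with extract e fs in eq
    ... | just gs = trans (cong (w e +_) (matched-sound es gs p)) (sym (extract-sound e fs eq))

newTriples oldTriples : List (Triple Label)
newTriples = A₁ ++ A₂ ++ A₃ ++ A₄ ++ A₅ ++ A₆ ++ A₇
oldTriples = square 0 ++ square 1 ++ square 2 ++ Bʳ ∷ Bᶜ ∷ Bˢ ∷ []

-- Each side has 21 triples, hence 63 pairs. A match of labels remains one after reduction modulo v,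
-- even where labels merge, as `σ 5` and `σ 1` do for v = 4.
trade : T (Matching.matched _≟ˡ_ (concatMap edges newTriples) (concatMap edges oldTriples))
trade = _

-- Adjacencies in the tripled point set

module Tripling (n : ℕ) where

  v : ℕ
  v = 4 + n

  open Cyclic v

  Point : Set
  Point = Fin 3 × Fin v

  _≟ᵖ_ : DecidableEquality Point
  _≟ᵖ_ = ≡-dec Fin._≟_ Fin._≟_

  module P = Incidence _≟ᵖ_

  pt : Label → Point
  pt (g , k) = g , [ k ]ᵥ

  pts : Triple Label → Triple Point
  pts = mapTriple pt

  near-≢ : ∀ {a b} → Near a b → a ≢ b → pt a ≢ pt b
  near-≢ (inj₁ g≢h) _ e = g≢h (cong proj₁ e)
  near-≢ {g , k} {h , l} (inj₂ d) a≢b e with <-cmp k l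
  ... | tri< k<l _ _ = []ᵥ-distinct k<l (≤-<-trans (≤-trans (m≤n+∣n-m∣ l k) (+-monoʳ-≤ k d)) (+-monoʳ-< k (m≤m+n 4 n))) (,-injectiveʳ e)
  ... | tri≈ _ refl _ = a≢b (cong (_, k) (cong proj₁ e))
  ... | tri> _ _ l<k = []ᵥ-distinct l<k (≤-<-trans (≤-trans (m≤n+∣m-n∣ k l) (+-monoʳ-≤ l d)) (+-monoʳ-< l (m≤m+n 4 n))) (sym (,-injectiveʳ e))

  δ-pt : ∀ a b → Near a b → P.δ (pt a) (pt b) ≡ L.δ a b
  δ-pt a b near with a ≟ˡ b
  ... | yes refl = P.δ-refl (pt a)
  ... | no a≢b   = P.δ-≢ (near-≢ near a≢b)

  mem-pt : ∀ x t → AllNear x t → P.mem (pt x) (pts t) ≡ L.mem x t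
  mem-pt x (a , b , c) (p , q , r) = cong₂ _+_ (cong₂ _+_ (δ-pt x a p) (δ-pt x b q)) (δ-pt x c r)

  step : ∀ t u → {True (step? t u)} → P.Adjacent (pts t) (pts u)
  step t@(a , b , c) u {w} with (p , q , r) , e ← toWitness {a? = step? t u} w =
    P.adjacent (trans (cong₂ _+_ (cong₂ _+_ (mem-pt a u p) (mem-pt b u q)) (mem-pt c u r)) e)

  proper : ∀ {t} → Proper t → Distinct (pts t)
  proper ((p , q , r) , (a≢b , a≢c , b≢c)) = near-≢ p a≢b , near-≢ q a≢c , near-≢ r b≢c

  chain : ∀ ts → Chain ts → Path P.Adjacent (pts (head ts)) (pts (final ts)) (map pts ts)
  chain (t ∷ [])         _        = end (pts t)
  chain (t ∷ us@(u ∷ _)) (p , ps) = step t u {p} ∷ chain us ps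

  transversals-common : ∀ (x y z x′ y′ z′ : Fin v) →
    P.common ((0F , x) , (1F , y) , (2F , z)) ((0F , x′) , (1F , y′) , (2F , z′)) ≡ δ x x′ + δ y y′ + δ z z′
  transversals-common x y z x′ y′ z′ = pad (δ x x′) (δ y y′) (δ z z′)
    where
    pad : ∀ k l m → (k + 0 + 0) + (l + 0) + m ≡ k + l + m
    pad = solve-∀

  next-≢ : ∀ k → [ k ]ᵥ ≢ [ suc k ]ᵥ
  next-≢ k = []ᵥ-distinct (n<1+n k) (subst (suc k <_) (+-comm v k) (s≤s (s≤s (m≤n+m k (2 + n)))))

  T₁~T₂ : ∀ x y → P.Adjacent (pts (T₁ x y)) (pts (T₂ x y))
  T₁~T₂ x y = P.adjacent (trans (transversals-common [ x ]ᵥ [ y ]ᵥ [ x + y ]ᵥ _ _ _)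
    (cong₂ _+_ (cong₂ _+_ (δ-refl [ x ]ᵥ) (δ-refl [ y ]ᵥ)) (δ-≢ (next-≢ (x + y)))))

  T₂~T₁ : ∀ x y → P.Adjacent (pts (T₂ x y)) (pts (T₁ x (suc y)))
  T₂~T₁ x y rewrite +-suc x y = P.adjacent (trans (transversals-common [ x ]ᵥ [ y ]ᵥ [ suc (x + y) ]ᵥ _ _ _)
    (cong₂ _+_ (cong₂ _+_ (δ-refl [ x ]ᵥ) (δ-≢ (next-≢ y))) (δ-refl [ suc (x + y) ]ᵥ)))

  T₁-periodic : ∀ x y → pts (T₁ x (y + v)) ≡ pts (T₁ x y)
  T₁-periodic x y = cong₂ (λ i j → (0F , [ x ]ᵥ) , (1F , i) , (2F , j)) (periodic y)
    (trans (cong [_]ᵥ (sym (+-assoc x y v))) (periodic (x + y)))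

  T₂-periodic : ∀ x y → pts (T₂ x (y + v)) ≡ pts (T₂ x y)
  T₂-periodic x y = cong₂ (λ i j → (0F , [ x ]ᵥ) , (1F , i) , (2F , j)) (periodic y)
    (trans (cong ([_]ᵥ ∘ suc) (sym (+-assoc x y v))) (periodic (suc (x + y))))

  -- The passage from a row to the one below it: same column, same symbol.
  T₁~T₂-below : ∀ x y → P.Adjacent (pts (T₁ (suc x) y)) (pts (T₂ x y))
  T₁~T₂-below x y = P.adjacent (trans (transversals-common [ suc x ]ᵥ [ y ]ᵥ [ suc (x + y) ]ᵥ _ _ _)
    (cong₂ _+_ (cong₂ _+_ (δ-≢ (next-≢ x ∘ sym)) (δ-refl [ y ]ᵥ)) (δ-refl [ suc (x + y) ]ᵥ)))

  row-path : ∀ x y m → Path P.Adjacent (pts (T₂ x y)) (pts (T₁ x (suc (y + m)))) (map pts (row x y m))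
  row-path x y zero    rewrite +-identityʳ y = T₂~T₁ x y ∷ end _
  row-path x y (suc m) rewrite +-suc y m = T₂~T₁ x y ∷ T₁~T₂ x (suc y) ∷ row-path x (suc y) m

  segment-path : ∀ x y m → Path P.Adjacent (pts (T₁ x y)) (pts (T₂ x (y + m))) (map pts (segment x y m))
  segment-path x y zero    rewrite +-identityʳ y = T₁~T₂ x y ∷ end _
  segment-path x y (suc m) rewrite +-suc y m = T₁~T₂ x y ∷ T₂~T₁ x y ∷ segment-path x (suc y) m

  -- After v columns the path reaches `T₁ x (1 + v)`, which is `T₁ x 1`. The whole cycle of the row
  -- is thus opened in column 1, where the passage to the next row is made.
  full-row-path : ∀ x → Path P.Adjacent (pts (T₂ x 1)) (pts (T₁ x 1)) (map pts (row x 1 (3 + n)))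
  full-row-path x = subst (λ t → Path P.Adjacent (pts (T₂ x 1)) t (map pts (row x 1 (3 + n)))) (T₁-periodic x 1) (row-path x 1 (3 + n))

  rows-path : ∀ k → Path P.Adjacent (pts (T₂ (3 + k) 1)) (pts (T₁ 3 1)) (map pts (rows (3 + n) k))
  rows-path zero    = full-row-path 3
  rows-path (suc k) = subst (Path P.Adjacent _ _) (sym (map-++ pts (row (4 + k) 1 (3 + n)) (rows (3 + n) k)))
    (join (full-row-path (4 + k)) (T₁~T₂-below (3 + k) 1) (rows-path k))

  -- Columns 4, ..., v, where column v is column 0; together with columns 1, 2, 3 of the trade these
  -- are all the columns.
  tail-path : ∀ x → Path P.Adjacent (pts (T₁ x 4)) (pts (T₂ x 0)) (map pts (segment x 4 n))
  tail-path x = subst (λ t → Path P.Adjacent (pts (T₁ x 4)) t (map pts (segment x 4 n))) (T₂-periodic x 0) (segment-path x 4 n)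

  copy : Fin 3 → List (Triple (Fin v)) → List (Triple Point)
  copy g = map (mapTriple (g ,_))

  module Copy (g : Fin 3) = Embed Fin._≟_ _≟ᵖ_ (λ i → g , i) ,-injectiveʳ

  mem-elsewhere : ∀ {g h} → g ≢ h → ∀ i t → P.mem (g , i) (mapTriple (h ,_) t) ≡ 0
  mem-elsewhere {g} {h} g≢h i (a , b , c) = cong₂ _+_ (cong₂ _+_ (elsewhere a) (elsewhere b)) (elsewhere c)
    where
    elsewhere : ∀ j → P.δ (g , i) (h , j) ≡ 0
    elsewhere j = P.δ-≢ (g≢h ∘ cong proj₁)

  enter : ∀ g {h} → h ≢ g → ∀ x y {z t} → mem x t ≡ 1 → mem y t ≡ 1 →
          P.Adjacent ((g , x) , (g , y) , (h , z)) (mapTriple (g ,_) t)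
  enter g h≢g x y {z} {t} x∈t y∈t = P.adjacent
    (cong₂ _+_ (cong₂ _+_ (trans (Copy.mem-map g x t) x∈t) (trans (Copy.mem-map g y t) y∈t)) (mem-elsewhere h≢g z t))

  leave : ∀ g {h} → h ≢ g → ∀ x y {z t} → mem x t ≡ 1 → mem y t ≡ 1 →
          P.Adjacent (mapTriple (g ,_) t) ((g , x) , (g , y) , (h , z))
  leave g h≢g x y {t = t} x∈t y∈t = P.adjacent
    (trans (P.common-sym (mapTriple (g ,_) t) _) (P.common≡2 (enter g h≢g x y {t = t} x∈t y∈t)))

  -- Counting the triples on a pair

  module Covering (p q : Point) where

    covˡ : Triple Label → ℕ
    covˡ t = P.cov p q (pts t)

    coverˡ : List (Triple Label) → ℕ
    coverˡ ts = P.cover p q (map pts ts)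

    cell : ℕ → ℕ → ℕ
    cell x y = covˡ (T₁ x y) + covˡ (T₂ x y)

    copyCover : Fin 3 → List (Triple (Fin v)) → Triple (Fin v) → ℕ
    copyCover g ts t = P.cover p q (copy g ts) + P.cov p q (mapTriple (g ,_) t)

    -- Columns run over 1, ..., v rather than 0, ..., v - 1, so that the three columns of the trade
    -- come first and the remaining ones form the tail.
    latin : ℕ
    latin = ∑[ x < v ] ∑[ y < v ] cell (toℕ x) (suc (toℕ y))

    cover-segment : ∀ x y m → coverˡ (segment x y m) ≡ ∑[ k < suc m ] cell x (y + toℕ k)
    cover-segment x y zero = trans (sym (+-assoc (covˡ (T₁ x y)) _ 0)) (cong (λ y → cell x y + 0) (sym (+-identityʳ y)))
    cover-segment x y (suc m) = trans (sym (+-assoc (covˡ (T₁ x y)) _ _)) (cong₂ _+_ (cong (cell x) (sym (+-identityʳ y)))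
      (trans (cover-segment x (suc y) m) (sum-cong-≗ {suc m} (λ k → cong (cell x) (sym (+-suc y (toℕ k)))))))

    cover-row : ∀ x y m → coverˡ (row x y m) ≡ ∑[ k < suc m ] covˡ (T₂ x (y + toℕ k)) + ∑[ k < suc m ] covˡ (T₁ x (suc y + toℕ k))
    cover-row x y zero rewrite +-identityʳ y = regroup (covˡ (T₂ x y)) (covˡ (T₁ x (suc y)))
      where
      regroup : ∀ k l → k + (l + 0) ≡ k + 0 + (l + 0)
      regroup = solve-∀
    cover-row x y (suc m) = begin
      a + (b + coverˡ (row x (suc y) m))      ≡⟨ cong (λ k → a + (b + k)) (cover-row x (suc y) m) ⟩
      a + (b + (∑[ k < suc m ] covˡ (T₂ x (suc y + toℕ k)) + ∑[ k < suc m ] covˡ (T₁ x (2 + y + toℕ k))))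
        ≡⟨ regroup a b _ _ ⟩
      (a + ∑[ k < suc m ] covˡ (T₂ x (suc y + toℕ k))) + (b + ∑[ k < suc m ] covˡ (T₁ x (2 + y + toℕ k)))
        ≡⟨ cong₂ _+_ (cong₂ _+_ (cong (covˡ ∘ T₂ x) (sym (+-identityʳ y))) (sum-cong-≗ {suc m} (λ k → cong (covˡ ∘ T₂ x) (sym (+-suc y (toℕ k))))))
                     (cong₂ _+_ (cong (covˡ ∘ T₁ x) (sym (+-identityʳ (suc y)))) (sum-cong-≗ {suc m} (λ k → cong (covˡ ∘ T₁ x) (sym (+-suc (suc y) (toℕ k)))))) ⟩
      ∑[ k < 2 + m ] covˡ (T₂ x (y + toℕ k)) + ∑[ k < 2 + m ] covˡ (T₁ x (suc y + toℕ k)) ∎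
      where
      open ≡-Reasoning
      a = covˡ (T₂ x y)
      b = covˡ (T₁ x (suc y))
      regroup : ∀ k l m n → k + (l + (m + n)) ≡ (k + m) + (l + n)
      regroup = solve-∀

    cover-full-row : ∀ x → coverˡ (row x 1 (3 + n)) ≡ ∑[ y < v ] cell x (suc (toℕ y))
    cover-full-row x = begin
      coverˡ (row x 1 (3 + n))                                                            ≡⟨ cover-row x 1 (3 + n) ⟩
      ∑[ k < v ] covˡ (T₂ x (suc (toℕ k))) + ∑[ k < v ] covˡ (T₁ x (2 + toℕ k))            ≡⟨ cong (∑[ k < v ] covˡ (T₂ x (suc (toℕ k))) +_) rotate ⟩
      ∑[ k < v ] covˡ (T₂ x (suc (toℕ k))) + ∑[ k < v ] covˡ (T₁ x (suc (toℕ k)))          ≡⟨ +-comm (∑[ k < v ] covˡ (T₂ x (suc (toℕ k)))) _ ⟩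
      ∑[ k < v ] covˡ (T₁ x (suc (toℕ k))) + ∑[ k < v ] covˡ (T₂ x (suc (toℕ k)))          ≡⟨ ∑-distrib-+ {v} (λ k → covˡ (T₁ x (suc (toℕ k)))) (λ k → covˡ (T₂ x (suc (toℕ k)))) ⟨
      ∑[ y < v ] cell x (suc (toℕ y))                                                    ∎
      where
      open ≡-Reasoning
      -- `row` takes `T₂` in columns 1, ..., v but `T₁` in columns 2, ..., v + 1; by periodicity the
      -- last column is column 1.
      rotate : ∑[ k < v ] covˡ (T₁ x (2 + toℕ k)) ≡ ∑[ k < v ] covˡ (T₁ x (suc (toℕ k)))
      rotate = +-cancelˡ-≡ (covˡ (T₁ x 1)) _ _ (begin
        ∑[ k < suc v ] covˡ (T₁ x (suc (toℕ k)))                        ≡⟨ ∑-last v (covˡ ∘ T₁ x ∘ suc) ⟩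
        ∑[ k < v ] covˡ (T₁ x (suc (toℕ k))) + covˡ (T₁ x (suc v))       ≡⟨ +-comm (∑[ k < v ] covˡ (T₁ x (suc (toℕ k)))) _ ⟩
        covˡ (T₁ x (suc v)) + ∑[ k < v ] covˡ (T₁ x (suc (toℕ k)))       ≡⟨ cong (λ t → P.cov p q t + ∑[ k < v ] covˡ (T₁ x (suc (toℕ k)))) (T₁-periodic x 1) ⟩
        covˡ (T₁ x 1) + ∑[ k < v ] covˡ (T₁ x (suc (toℕ k)))             ∎)

    cover-rows : ∀ k → coverˡ (rows (3 + n) k) ≡ ∑[ i < suc k ] ∑[ y < v ] cell (3 + toℕ i) (suc (toℕ y))
    cover-rows zero    = trans (cover-full-row 3) (sym (+-identityʳ _))
    cover-rows (suc k) = begin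
      coverˡ (row (4 + k) 1 (3 + n) ++ rows (3 + n) k)            ≡⟨ cong (P.cover p q) (map-++ pts (row (4 + k) 1 (3 + n)) (rows (3 + n) k)) ⟩
      P.cover p q (map pts (row (4 + k) 1 (3 + n)) ++ map pts (rows (3 + n) k))
        ≡⟨ P.cover-++ p q (map pts (row (4 + k) 1 (3 + n))) _ ⟩
      coverˡ (row (4 + k) 1 (3 + n)) + coverˡ (rows (3 + n) k)     ≡⟨ cong₂ _+_ (cover-full-row (4 + k)) (cover-rows k) ⟩
      f (suc k) + ∑[ i < suc k ] f (toℕ i)                       ≡⟨ +-comm (f (suc k)) _ ⟩
      ∑[ i < suc k ] f (toℕ i) + f (suc k)                       ≡⟨ ∑-last (suc k) f ⟨
      ∑[ i < 2 + k ] f (toℕ i)                                   ∎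
      where
      open ≡-Reasoning
      f : ℕ → ℕ
      f i = ∑[ y < v ] cell (3 + i) (suc (toℕ y))

    tail : ℕ → ℕ
    tail x = coverˡ (segment x 4 n)

    -- As `v` is `4 + n` by definition, the sums unfold by computation along the rows and columns of
    -- the trade.
    latin-split : latin ≡ cell 0 1 + (cell 0 2 + (cell 0 3 + tail 0)) +
                         (cell 1 1 + (cell 1 2 + (cell 1 3 + tail 1)) +
                         (cell 2 1 + (cell 2 2 + (cell 2 3 + tail 2)) + coverˡ (rows (3 + n) n)))
    latin-split rewrite cover-segment 0 4 n | cover-segment 1 4 n | cover-segment 2 4 n | cover-rows n = refl

    module _ (p≢q : p ≢ q) where

      weight : Label × Label → ℕ
      weight (a , b) = P.δ p (pt a) * P.δ q (pt b) + P.δ p (pt b) * P.δ q (pt a)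

      -- In the expanded product the terms that place p and q on the same entry vanish, as p ≢ q;
      -- the others group into one weight for each pair of entries.
      cov-edges : ∀ t → covˡ t ≡ sum (map weight (edges t))
      cov-edges (a , b , c) = trans (expand (P.δ p (pt a)) (P.δ p (pt b)) (P.δ p (pt c)) (P.δ q (pt a)) (P.δ q (pt b)) (P.δ q (pt c)))
        (cong (_+ sum (map weight (edges (a , b , c))))
          (cong₂ _+_ (cong₂ _+_ (P.δ-exclusive p≢q (pt a)) (P.δ-exclusive p≢q (pt b))) (P.δ-exclusive p≢q (pt c))))
        where
        expand : ∀ x y z x′ y′ z′ → (x + y + z) * (x′ + y′ + z′) ≡
          (x * x′ + y * y′ + z * z′) + ((x * y′ + y * x′) + ((x * z′ + z * x′) + ((y * z′ + z * y′) + 0)))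
        expand = solve-∀

      cover-edges : ∀ ts → coverˡ ts ≡ sum (map weight (concatMap edges ts))
      cover-edges []       = refl
      cover-edges (t ∷ ts) = begin
        covˡ t + coverˡ ts                                                         ≡⟨ cong₂ _+_ (cov-edges t) (cover-edges ts) ⟩
        sum (map weight (edges t)) + sum (map weight (concatMap edges ts))       ≡⟨ sum-++ (map weight (edges t)) (map weight (concatMap edges ts)) ⟨
        sum (map weight (edges t) ++ map weight (concatMap edges ts))            ≡⟨ cong sum (map-++ weight (edges t) (concatMap edges ts)) ⟨
        sum (map weight (concatMap edges (t ∷ ts)))                              ∎
        where open ≡-Reasoning

      cover-trade : coverˡ newTriples ≡ coverˡ oldTriples
      cover-trade = trans (cover-edges newTriples) (trans
        (Matching.matched-sound _≟ˡ_ weight (λ a b → +-comm (P.δ p (pt a) * P.δ q (pt b)) _) (concatMap edges newTriples) (concatMap edges oldTriples) trade)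
        (sym (cover-edges oldTriples)))

  mem-transversal : ∀ g i (a b c : Fin v) →
    P.mem (g , i) ((0F , a) , (1F , b) , (2F , c)) ≡ δ i (Vec.lookup (a ∷ b ∷ c ∷ []) g)
  mem-transversal 0F i a b c = trans (+-identityʳ _) (+-identityʳ _)
  mem-transversal 1F i a b c = +-identityʳ _
  mem-transversal 2F i a b c = refl

  entry : ℕ → ℕ → ℕ → Fin 3 → Fin v
  entry d x y = Vec.lookup ([ x ]ᵥ ∷ [ y ]ᵥ ∷ [ d + (x + y) ]ᵥ ∷ [])

  module _ (i j : Fin v) where

    coordinates : Fin 3 → Fin 3 → ℕ → ℕ → ℕ → ℕ
    coordinates g h d x y = δ i (entry d x y g) * δ j (entry d x y h)

    latin-coordinates : ∀ g h → Covering.latin (g , i) (h , j) ≡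
      ∑[ x < v ] ∑[ y < v ] coordinates g h 0 (toℕ x) (suc (toℕ y)) +
      ∑[ x < v ] ∑[ y < v ] coordinates g h 1 (toℕ x) (suc (toℕ y))
    latin-coordinates g h = begin
      ∑[ x < v ] ∑[ y < v ] cell (toℕ x) (suc (toℕ y))
        ≡⟨ sum-cong-≗ {v} (λ x → sum-cong-≗ {v} (λ y → cong₂ _+_
             (cov-coordinates 0 (toℕ x) (suc (toℕ y))) (cov-coordinates 1 (toℕ x) (suc (toℕ y))))) ⟩
      ∑[ x < v ] ∑[ y < v ] (f 0 x y + f 1 x y)
        ≡⟨ sum-cong-≗ {v} (λ x → ∑-distrib-+ (f 0 x) (f 1 x)) ⟩
      ∑[ x < v ] (∑[ y < v ] f 0 x y + ∑[ y < v ] f 1 x y)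
        ≡⟨ ∑-distrib-+ {v} (λ x → ∑[ y < v ] f 0 x y) (λ x → ∑[ y < v ] f 1 x y) ⟩
      ∑[ x < v ] ∑[ y < v ] f 0 x y + ∑[ x < v ] ∑[ y < v ] f 1 x y ∎
      where
      open ≡-Reasoning
      open Covering (g , i) (h , j)
      f : ℕ → Fin v → Fin v → ℕ
      f d x y = coordinates g h d (toℕ x) (suc (toℕ y))
      cov-coordinates : ∀ d x y → P.cov (g , i) (h , j) (pts (ρ x , κ y , σ (d + (x + y)))) ≡ coordinates g h d x y
      cov-coordinates d x y = cong₂ _*_
        (mem-transversal g i [ x ]ᵥ [ y ]ᵥ [ d + (x + y) ]ᵥ) (mem-transversal h j [ x ]ᵥ [ y ]ᵥ [ d + (x + y) ]ᵥ)

    -- A transversal triple has a single point in copy g, which cannot be both i and j.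
    latin-inside : i ≢ j → ∀ g → Covering.latin (g , i) (g , j) ≡ 0
    latin-inside i≢j g = trans (latin-coordinates g g) (cong₂ _+_ (vanish 0) (vanish 1))
      where
      vanish : ∀ d → ∑[ x < v ] ∑[ y < v ] coordinates g g d (toℕ x) (suc (toℕ y)) ≡ 0
      vanish d = ∑-zero {v} (λ x → ∑-zero {v} (λ y → δ-exclusive i≢j (entry d (toℕ x) (suc (toℕ y)) g)))

    latin₀₁ : Covering.latin (0F , i) (1F , j) ≡ 2
    latin₀₁ = trans (latin-coordinates 0F 1F) (cong₂ _+_ once once)
      where
      once : ∑[ x < v ] ∑[ y < v ] (δ i [ toℕ x ]ᵥ * δ j [ suc (toℕ y) ]ᵥ) ≡ 1
      once = ∑∑-product (λ x → δ i [ toℕ x ]ᵥ) (λ x y → δ j [ suc (toℕ y) ]ᵥ) (∑-hit i 0) (λ _ → ∑-hit j 1)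

    latin₀₂ : Covering.latin (0F , i) (2F , j) ≡ 2
    latin₀₂ = trans (latin-coordinates 0F 2F) (cong₂ _+_ (once 0) (once 1))
      where
      once : ∀ d → ∑[ x < v ] ∑[ y < v ] (δ i [ toℕ x ]ᵥ * δ j [ d + (toℕ x + suc (toℕ y)) ]ᵥ) ≡ 1
      once d = ∑∑-product (λ x → δ i [ toℕ x ]ᵥ) (λ x y → δ j [ d + (toℕ x + suc (toℕ y)) ]ᵥ) (∑-hit i 0)
        (λ x → trans (sum-cong-≗ {v} (λ y → cong (δ j ∘ [_]ᵥ) (regroup d (toℕ x) (toℕ y)))) (∑-hit j (d + toℕ x + 1)))
        where
        regroup : ∀ d x y → d + (x + suc y) ≡ d + x + 1 + y
        regroup = solve-∀

    latin₁₂ : Covering.latin (1F , i) (2F , j) ≡ 2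
    latin₁₂ = trans (latin-coordinates 1F 2F) (cong₂ _+_ (once 0) (once 1))
      where
      once : ∀ d → ∑[ x < v ] ∑[ y < v ] (δ i [ suc (toℕ y) ]ᵥ * δ j [ d + (toℕ x + suc (toℕ y)) ]ᵥ) ≡ 1
      -- The column fixes y, so the sum over y must become the outer one; the symbol then runs
      -- through all residues with x.
      once d = trans (∑-comm {v} {v} (λ x y → δ i [ suc (toℕ y) ]ᵥ * δ j [ d + (toℕ x + suc (toℕ y)) ]ᵥ))
        (∑∑-product (λ y → δ i [ suc (toℕ y) ]ᵥ) (λ y x → δ j [ d + (toℕ x + suc (toℕ y)) ]ᵥ) (∑-hit i 1)
          (λ y → trans (sum-cong-≗ {v} (λ x → cong (δ j ∘ [_]ᵥ) (regroup d (toℕ x) (toℕ y)))) (∑-hit j (d + suc (toℕ y)))))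
        where
        regroup : ∀ d x y → d + (x + suc y) ≡ d + suc y + x
        regroup = solve-∀

  latin-sym : ∀ p q → Covering.latin p q ≡ Covering.latin q p
  latin-sym p q = sum-cong-≗ {v} (λ x → sum-cong-≗ {v} (λ y →
    cong₂ _+_ (*-comm (P.mem p (pts (T₁ (toℕ x) (suc (toℕ y))))) (P.mem q (pts (T₁ (toℕ x) (suc (toℕ y))))))
              (*-comm (P.mem p (pts (T₂ (toℕ x) (suc (toℕ y))))) (P.mem q (pts (T₂ (toℕ x) (suc (toℕ y))))))))

  copy-inside : ∀ g {e f k} (C : CutCode e f k) {i j} → i ≢ j →
    Covering.copyCover (g , i) (g , j) g (CutCode.triples C) (e , f , k) ≡ 2
  copy-inside g {e} {f} {k} C {i} {j} i≢j =
    trans (cong₂ _+_ (Copy.cover-map g i j (CutCode.triples C)) (Copy.cov-map g i j (e , f , k))) (CutCode.balanced C i≢j)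

  copy-outside : ∀ g (p q : Point) → proj₁ p ≢ g ⊎ proj₁ q ≢ g → ∀ ts t →
    Covering.copyCover p q g ts t ≡ 0
  copy-outside g p q out ts t = cong₂ _+_ (none ts) (cov≡0 out t)
    where
    cov≡0 : proj₁ p ≢ g ⊎ proj₁ q ≢ g → ∀ t → P.cov p q (mapTriple (g ,_) t) ≡ 0
    cov≡0 (inj₁ p≢g) t = cong (_* P.mem q (mapTriple (g ,_) t)) (mem-elsewhere p≢g (proj₂ p) t)
    cov≡0 (inj₂ q≢g) t = trans (cong (P.mem p (mapTriple (g ,_) t) *_) (mem-elsewhere q≢g (proj₂ q) t)) (*-zeroʳ (P.mem p (mapTriple (g ,_) t)))
    none : ∀ ts → P.cover p q (copy g ts) ≡ 0
    none []       = refl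
    none (t ∷ ts) = cong₂ _+_ (cov≡0 out t) (none ts)

  -- Assembling the Hamilton cycle and checking balance

  module Build (Cʳ : CutCode [ 0 ]ᵥ [ 1 ]ᵥ [ 2 ]ᵥ) (Cᶜ : CutCode [ 2 ]ᵥ [ 3 ]ᵥ [ 1 ]ᵥ) (Cˢ : CutCode [ 3 ]ᵥ [ 2 ]ᵥ [ 1 ]ᵥ) where
    module Cʳ = CutCode Cʳ
    module Cᶜ = CutCode Cᶜ
    module Cˢ = CutCode Cˢ

    bʳ bᶜ bˢ : Triple (Fin v)
    bʳ = [ 0 ]ᵥ , [ 1 ]ᵥ , [ 2 ]ᵥ
    bᶜ = [ 2 ]ᵥ , [ 3 ]ᵥ , [ 1 ]ᵥ
    bˢ = [ 3 ]ᵥ , [ 2 ]ᵥ , [ 1 ]ᵥ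

    -- Row 2 comes first because the untouched rows end in `T₁ 3 1`, from which the usual passage
    -- down leads to `T₂ 2 1`. The copies are spliced in between rows 2, 0, 1 and the untouched
    -- rows.
    triples : List (Triple Point)
    triples = map pts A₁ ++ map pts (segment 2 4 n) ++ map pts A₂ ++ copy 0F Cʳ.triples ++
              map pts A₃ ++ map pts (segment 0 4 n) ++ map pts A₄ ++ copy 1F Cᶜ.triples ++
              map pts A₅ ++ map pts (segment 1 4 n) ++ map pts A₆ ++ copy 2F Cˢ.triples ++
              map pts A₇ ++ map pts (rows (3 + n) n)

    path : Path P.Adjacent (pts (T₂ 2 1)) (pts (T₁ 3 1)) triples
    path =
      join (chain A₁ _) (step (T₂ 2 3) (T₁ 2 4)) (
      join (tail-path 2) (step (T₂ 2 0) (ρ 1 , ρ 2 , σ 3)) (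
      join (chain A₂ _) (enter 0F (λ ()) [ 0 ]ᵥ [ 1 ]ᵥ Cʳ.e∈first Cʳ.f∈first) (
      join (Copy.path-map 0F Cʳ.path) (leave 0F (λ ()) [ 0 ]ᵥ [ 2 ]ᵥ Cʳ.e∈final Cʳ.g∈final) (
      join (chain A₃ _) (step (T₂ 0 3) (T₁ 0 4)) (
      join (tail-path 0) (step (T₂ 0 0) (ρ 0 , σ 1 , σ 2)) (
      join (chain A₄ _) (enter 1F (λ ()) [ 2 ]ᵥ [ 3 ]ᵥ Cᶜ.e∈first Cᶜ.f∈first) (
      join (Copy.path-map 1F Cᶜ.path) (leave 1F (λ ()) [ 2 ]ᵥ [ 1 ]ᵥ Cᶜ.e∈final Cᶜ.g∈final) (
      join (chain A₅ _) (step (T₂ 1 3) (T₁ 1 4)) (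
      join (tail-path 1) (step (T₂ 1 0) (T₁ 1 1)) (
      join (chain A₆ _) (enter 2F (λ ()) [ 3 ]ᵥ [ 2 ]ᵥ Cˢ.e∈first Cˢ.f∈first) (
      join (Copy.path-map 2F Cˢ.path) (leave 2F (λ ()) [ 3 ]ᵥ [ 1 ]ᵥ Cˢ.e∈final Cˢ.g∈final) (
      join (chain A₇ _) wrap (
      rows-path n)))))))))))))
      where
      -- The symbol of `T₂ (3 + n) 1` is v + 1, the same point as `σ 1`. Written as `σ 1` it is near
      -- the other labels, and the step is decided although `n` is a variable.
      wrap : P.Adjacent (pts (σ 3 , σ 1 , κ 1)) (pts (T₂ (3 + n) 1))
      wrap = subst (P.Adjacent (pts (σ 3 , σ 1 , κ 1))) (cong (λ i → (0F , [ 3 + n ]ᵥ) , (1F , [ 1 ]ᵥ) , (2F , i)) (trans (sym (periodic 1)) (cong [_]ᵥ (cong (4 +_) (+-comm 1 n)))))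
        (step (σ 3 , σ 1 , κ 1) (ρ (3 + n) , κ 1 , σ 1))

    closes : P.Adjacent (pts (T₁ 3 1)) (pts (T₂ 2 1))
    closes = T₁~T₂-below 2 1

    distinct : All Distinct triples
    distinct =
      All.++⁺ (explicit A₁ _) (All.++⁺ (transversal-segment 2 4 n) (All.++⁺ (explicit A₂ _) (All.++⁺ (Copy.distinct-map 0F Cʳ.distinct) (
      All.++⁺ (explicit A₃ _) (All.++⁺ (transversal-segment 0 4 n) (All.++⁺ (explicit A₄ _) (All.++⁺ (Copy.distinct-map 1F Cᶜ.distinct) (
      All.++⁺ (explicit A₅ _) (All.++⁺ (transversal-segment 1 4 n) (All.++⁺ (explicit A₆ _) (All.++⁺ (Copy.distinct-map 2F Cˢ.distinct) (
      All.++⁺ (explicit A₇ _) (transversal-rows (3 + n) n)))))))))))))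
      where
      explicit : ∀ ts → True (all? proper? ts) → All Distinct (map pts ts)
      explicit ts p = All.map⁺ (All.map proper (toWitness p))
      transversal : ∀ {x y z : Fin v} → Distinct {Point} ((0F , x) , (1F , y) , (2F , z))
      transversal = (λ ()) , (λ ()) , (λ ())
      transversal-row : ∀ x y m → All Distinct (map pts (row x y m))
      transversal-row x y zero    = transversal ∷ transversal ∷ []
      transversal-row x y (suc m) = transversal ∷ transversal ∷ transversal-row x (suc y) m
      transversal-segment : ∀ x y m → All Distinct (map pts (segment x y m))
      transversal-segment x y zero    = transversal ∷ transversal ∷ []
      transversal-segment x y (suc m) = transversal ∷ transversal ∷ transversal-segment x (suc y) m
      transversal-rows : ∀ m k → All Distinct (map pts (rows m k))
      transversal-rows m zero    = transversal-row 3 1 m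
      transversal-rows m (suc k) = subst (All Distinct) (sym (map-++ pts (row (4 + k) 1 m) (rows m k)))
        (All.++⁺ (transversal-row (4 + k) 1 m) (transversal-rows m k))

    module _ {p q : Point} (p≢q : p ≢ q) where
      open Covering p q

      -- Wrapped so that the list can be inferred from the type in nested uses of `plus`.
      record Covers (ts : List (Triple Point)) (m : ℕ) : Set where
        constructor covers
        field
          cover≡ : P.cover p q ts ≡ m

      open Covers

      plus : ∀ ts {us m} → Covers us m → Covers (ts ++ us) (P.cover p q ts + m)
      plus ts {us} (covers refl) = covers (P.cover-++ p q ts us)

      cover-square : ∀ x → coverˡ (square x) ≡ cell x 1 + (cell x 2 + cell x 3)
      cover-square x = regroup (covˡ (T₁ x 1)) (covˡ (T₂ x 1)) (covˡ (T₁ x 2)) (covˡ (T₂ x 2)) (covˡ (T₁ x 3)) (covˡ (T₂ x 3))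
        where
        regroup : ∀ a b c d e f → a + (b + (c + (d + (e + (f + 0))))) ≡ (a + b) + ((c + d) + (e + f))
        regroup = solve-∀

      -- The pieces `A₁` to `A₇` are exchanged for the old triples, whose cells then rejoin their
      -- rows and whose blocks rejoin their copies. What is counted is the design before the trade.
      cover-triples : P.cover p q triples ≡
        latin + (copyCover 0F Cʳ.triples bʳ + copyCover 1F Cᶜ.triples bᶜ + copyCover 2F Cˢ.triples bˢ)
      cover-triples = begin
        P.cover p q triples
          ≡⟨ cover≡ (plus (map pts A₁) (plus (map pts (segment 2 4 n)) (plus (map pts A₂) (plus (copy 0F Cʳ.triples)
            (plus (map pts A₃) (plus (map pts (segment 0 4 n)) (plus (map pts A₄) (plus (copy 1F Cᶜ.triples)
            (plus (map pts A₅) (plus (map pts (segment 1 4 n)) (plus (map pts A₆) (plus (copy 2F Cˢ.triples)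
            (plus (map pts A₇) (covers refl)))))))))))))) ⟩
        coverˡ A₁ + (tail 2 + (coverˡ A₂ + (dʳ + (coverˡ A₃ + (tail 0 + (coverˡ A₄ + (dᶜ +
          (coverˡ A₅ + (tail 1 + (coverˡ A₆ + (dˢ + (coverˡ A₇ + outer))))))))))))
          ≡⟨ collect (coverˡ A₁) (coverˡ A₂) (coverˡ A₃) (coverˡ A₄) (coverˡ A₅) (coverˡ A₆) (coverˡ A₇) (tail 2) dʳ (tail 0) dᶜ (tail 1) dˢ outer ⟩
        (coverˡ A₁ + (coverˡ A₂ + (coverˡ A₃ + (coverˡ A₄ + (coverˡ A₅ + (coverˡ A₆ + coverˡ A₇)))))) + rest
          ≡⟨ cong (_+ rest) (cover≡ (plus (map pts A₁) (plus (map pts A₂) (plus (map pts A₃) (plus (map pts A₄) (plus (map pts A₅) (plus (map pts A₆) (covers {map pts A₇} refl)))))))) ⟨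
        coverˡ newTriples + rest
          ≡⟨ cong (_+ rest) (cover-trade p≢q) ⟩
        coverˡ oldTriples + rest
          ≡⟨ cong (_+ rest) (trans (cover≡ (plus (map pts (square 0)) (plus (map pts (square 1)) (plus (map pts (square 2)) (covers {map pts (Bʳ ∷ Bᶜ ∷ Bˢ ∷ [])} refl)))))
               (cong₂ _+_ (cover-square 0) (cong₂ _+_ (cover-square 1) (cong (_+ (covˡ Bʳ + (covˡ Bᶜ + (covˡ Bˢ + 0)))) (cover-square 2))))) ⟩
        (e 0 + (e 1 + (e 2 + (covˡ Bʳ + (covˡ Bᶜ + (covˡ Bˢ + 0)))))) + rest
          ≡⟨ distribute (e 0) (e 1) (e 2) (covˡ Bʳ) (covˡ Bᶜ) (covˡ Bˢ) (tail 0) (tail 1) (tail 2) outer dʳ dᶜ dˢ ⟩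
        ((e 0 + tail 0) + ((e 1 + tail 1) + ((e 2 + tail 2) + outer))) + copies
          ≡⟨ cong (_+ copies) (cong₂ _+_ (nest 0) (cong₂ _+_ (nest 1) (cong (_+ outer) (nest 2)))) ⟩
        (cell 0 1 + (cell 0 2 + (cell 0 3 + tail 0)) + (cell 1 1 + (cell 1 2 + (cell 1 3 + tail 1)) +
          (cell 2 1 + (cell 2 2 + (cell 2 3 + tail 2)) + outer))) + copies
          ≡⟨ cong (_+ copies) latin-split ⟨
        latin + copies ∎
        where
        open ≡-Reasoning
        dʳ = P.cover p q (copy 0F Cʳ.triples)
        dᶜ = P.cover p q (copy 1F Cᶜ.triples)
        dˢ = P.cover p q (copy 2F Cˢ.triples)
        outer = coverˡ (rows (3 + n) n)
        rest = tail 0 + tail 1 + tail 2 + outer + (dʳ + dᶜ + dˢ)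
        copies = copyCover 0F Cʳ.triples bʳ + copyCover 1F Cᶜ.triples bᶜ + copyCover 2F Cˢ.triples bˢ
        e : ℕ → ℕ
        e x = cell x 1 + (cell x 2 + cell x 3)
        nest : ∀ x → e x + tail x ≡ cell x 1 + (cell x 2 + (cell x 3 + tail x))
        nest x = trans (+-assoc (cell x 1) _ _) (cong (cell x 1 +_) (+-assoc (cell x 2) _ _))
        collect : ∀ a₁ a₂ a₃ a₄ a₅ a₆ a₇ s₂ x s₀ y s₁ z o →
          a₁ + (s₂ + (a₂ + (x + (a₃ + (s₀ + (a₄ + (y + (a₅ + (s₁ + (a₆ + (z + (a₇ + o)))))))))))) ≡
          (a₁ + (a₂ + (a₃ + (a₄ + (a₅ + (a₆ + a₇)))))) + (s₀ + s₁ + s₂ + o + (x + y + z))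
        collect = solve-∀
        distribute : ∀ e₀ e₁ e₂ b₀ b₁ b₂ s₀ s₁ s₂ o x y z →
          (e₀ + (e₁ + (e₂ + (b₀ + (b₁ + (b₂ + 0)))))) + (s₀ + s₁ + s₂ + o + (x + y + z)) ≡
          ((e₀ + s₀) + ((e₁ + s₁) + ((e₂ + s₂) + o))) + ((x + b₀) + (y + b₁) + (z + b₂))
        distribute = solve-∀

    -- A pair inside a copy receives 2 from that copy and 0 from the Latin squares; a pair across
    -- copies receives 2 from the Latin squares and 0 from every copy.
    balanced : ∀ {p q} → p ≢ q → P.cover p q triples ≡ 2
    balanced {p} {q} p≢q = trans (cover-triples p≢q) (cases p q p≢q)
      where
      combine₃ : ∀ {k k₀ k₁ k₂ l l₀ l₁ l₂} → k ≡ l → k₀ ≡ l₀ → k₁ ≡ l₁ → k₂ ≡ l₂ → k + (k₀ + k₁ + k₂) ≡ l + (l₀ + l₁ + l₂)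
      combine₃ refl refl refl refl = refl
      out₀ : ∀ p q → proj₁ p ≢ 0F ⊎ proj₁ q ≢ 0F → Covering.copyCover p q 0F Cʳ.triples bʳ ≡ 0
      out₀ p q out = copy-outside 0F p q out Cʳ.triples bʳ
      out₁ : ∀ p q → proj₁ p ≢ 1F ⊎ proj₁ q ≢ 1F → Covering.copyCover p q 1F Cᶜ.triples bᶜ ≡ 0
      out₁ p q out = copy-outside 1F p q out Cᶜ.triples bᶜ
      out₂ : ∀ p q → proj₁ p ≢ 2F ⊎ proj₁ q ≢ 2F → Covering.copyCover p q 2F Cˢ.triples bˢ ≡ 0
      out₂ p q out = copy-outside 2F p q out Cˢ.triples bˢ
      cases : ∀ p q → p ≢ q → let open Covering p q in
        latin + (copyCover 0F Cʳ.triples bʳ + copyCover 1F Cᶜ.triples bᶜ + copyCover 2F Cˢ.triples bˢ) ≡ 2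
      cases p@(0F , i) q@(0F , j) p≢q = combine₃ (latin-inside i j (p≢q ∘ cong (0F ,_)) 0F)
        (copy-inside 0F Cʳ (p≢q ∘ cong (0F ,_))) (out₁ p q (inj₁ λ ())) (out₂ p q (inj₁ λ ()))
      cases p@(1F , i) q@(1F , j) p≢q = combine₃ (latin-inside i j (p≢q ∘ cong (1F ,_)) 1F)
        (out₀ p q (inj₁ λ ())) (copy-inside 1F Cᶜ (p≢q ∘ cong (1F ,_))) (out₂ p q (inj₁ λ ()))
      cases p@(2F , i) q@(2F , j) p≢q = combine₃ (latin-inside i j (p≢q ∘ cong (2F ,_)) 2F)
        (out₀ p q (inj₁ λ ())) (out₁ p q (inj₁ λ ())) (copy-inside 2F Cˢ (p≢q ∘ cong (2F ,_)))
      cases p@(0F , i) q@(1F , j) _ = combine₃ (latin₀₁ i j)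
        (out₀ p q (inj₂ λ ())) (out₁ p q (inj₁ λ ())) (out₂ p q (inj₁ λ ()))
      cases p@(0F , i) q@(2F , j) _ = combine₃ (latin₀₂ i j)
        (out₀ p q (inj₂ λ ())) (out₁ p q (inj₁ λ ())) (out₂ p q (inj₁ λ ()))
      cases p@(1F , i) q@(0F , j) _ = combine₃ (trans (latin-sym (1F , i) (0F , j)) (latin₀₁ j i))
        (out₀ p q (inj₁ λ ())) (out₁ p q (inj₂ λ ())) (out₂ p q (inj₁ λ ()))
      cases p@(1F , i) q@(2F , j) _ = combine₃ (latin₁₂ i j)
        (out₀ p q (inj₁ λ ())) (out₁ p q (inj₂ λ ())) (out₂ p q (inj₁ λ ()))
      cases p@(2F , i) q@(0F , j) _ = combine₃ (trans (latin-sym (2F , i) (0F , j)) (latin₀₂ j i))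
        (out₀ p q (inj₁ λ ())) (out₁ p q (inj₁ λ ())) (out₂ p q (inj₂ λ ()))
      cases p@(2F , i) q@(1F , j) _ = combine₃ (trans (latin-sym (2F , i) (1F , j)) (latin₁₂ j i))
        (out₀ p q (inj₁ λ ())) (out₁ p q (inj₁ λ ())) (out₂ p q (inj₂ λ ()))

    grayCode : P.GrayCode
    grayCode = record { path = path ; closes = closes ; long = s≤s (s≤s (s≤s z≤n)) ; distinct = distinct ; balanced = balanced }

-- Renumbering the points, and the conclusion

transport : ∀ {A B : Set} (_≟ᴬ_ : DecidableEquality A) (_≟ᴮ_ : DecidableEquality B) (h : A → B) →
  (∀ {x y} → h x ≡ h y → x ≡ y) → (∀ y → ∃[ x ] h x ≡ y) →
  Incidence.GrayCode _≟ᴬ_ → Incidence.GrayCode _≟ᴮ_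
transport _≟ᴬ_ _≟ᴮ_ h h-injective h-surjective G = record
  { path     = path-map path
  ; closes   = Incidence.adjacent (trans (common-map _ _) (Incidence.common≡2 closes))
  ; long     = subst (3 ≤_) (sym (length-map (mapTriple h) triples)) long
  ; distinct = distinct-map distinct
  ; balanced = balanced′
  }
  where
  open Embed _≟ᴬ_ _≟ᴮ_ h h-injective
  open Incidence.GrayCode G
  balanced′ : ∀ {p q} → p ≢ q → Incidence.cover _≟ᴮ_ p q (map (mapTriple h) triples) ≡ 2
  balanced′ {p} {q} p≢q with h-surjective p | h-surjective q
  ... | p′ , refl | q′ , refl = trans (cover-map p′ q′ triples) (balanced (p≢q ∘ cong h))

triple-grayCode : ∀ n → GrayCode-Fin (4 + n) → GrayCode-Fin (3 * (4 + n))
triple-grayCode n G = transport _≟ᵖ_ Fin._≟_ (uncurry combine)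
  (λ { {g , i} {h , j} e → let g≡h , i≡j = combine-injective g i h j e in cong₂ _,_ g≡h i≡j })
  (λ y → remQuot {3} v y , combine-remQuot {3} v y)
  -- The same Gray code is put on all three copies; only the relabelling, and with it the place of
  -- the removed block, differs.
  (Build.grayCode (cut-at G (d 0 1 , d 0 2 , d 1 2)) (cut-at G (d 2 3 , d 1 2 ∘ sym , d 1 3 ∘ sym)) (cut-at G (d 2 3 ∘ sym , d 1 3 ∘ sym , d 1 2 ∘ sym)))
  where
  open Tripling n
  open Cyclic v
  d : ∀ k l → {True (suc k ≤? l)} → {True (l ≤? 3)} → [ k ]ᵥ ≢ [ l ]ᵥ
  d k l {p} {q} = []ᵥ-distinct (toWitness p) (≤-trans (s≤s (toWitness q)) (≤-trans (m≤m+n 4 n) (m≤n+m v k)))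

theorem6p2 : (v : ℕ) → 4 ≤ v →
    Σ[ D ∈ TTS v ] Hamiltonian (2-BIG D) →
    Σ[ D ∈ TTS (3 * v) ] Hamiltonian (2-BIG D)
theorem6p2 v 4≤v DH with n , refl ← m≤n⇒∃[o]m+o≡n 4≤v = fromGrayCode (triple-grayCode n (toGrayCode DH))
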